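{- Let $k\geq 2$ be an integer and let $\mathbf{t}^{(k)}$ be the generalized Thue-Morse sequence defined below. For every integer $n\geq k$, writing $n\equiv r \pmod k$ with $r\in\{0,1,\dots,k-1\}$, we have \[\rho_n^{ab}(\mathbf{t}^{(k)}) = \begin{cases} \frac{1}{4}k(k^2-1)+1 & \text{if $k$ is odd and $r=0$},\\ \frac{1}{4}k(k-1)^2+k & \text{if $k$ is odd and $r\neq 0$},\\ \frac{1}{4}k^3+1 & \text{if $k$ is even and $r=0$},\\ \frac{1}{4}k(k-1)^2+\frac{5}{4}k & \text{if $k$ is even and $r\neq 0$ is even},\\ \frac{1}{4}k^2(k-2)+k & \text{if $k$ is even and $r\neq 0$ is odd}. \end{cases}\]
   Context: Let $\Sigma_k=\{0,1,\dots,k-1\}$. Let $\sigma_k$ be the morphism on $\Sigma_k^*$ given by $\sigma_k(i)=i\,(i+1)\,(i+2)\cdots(i+k-1)$ with all letters taken modulo $k$ (so $0\mapsto 01\cdots(k-1)$, $1\mapsto 12\cdots(k-1)0$, etc.). The generalized Thue-Morse sequence is $\mathbf{t}^{(k)}=\sigma_k^\infty(0)$, the infinite fixed point of $\sigma_k$ beginning with $0$. For a word $v$ over $\Sigma_k$, its Parikh vector is $\psi(v)=(|v|_0,|v|_1,\dots,|v|_{k-1})$, where $|v|_a$ is the number of occurrences of the letter $a$ in $v$. For an infinite word $\mathbf{w}$, $\mathcal{F}_n(\mathbf{w})$ denotes the set of its factors (contiguous finite subwords) of length $n$, and the abelian complexity is $\rho_n^{ab}(\mathbf{w})=\#\{\psi(v):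 v\in\mathcal{F}_n(\mathbf{w})\}$. -}

module Defs where

open import Data.Nat using (ℕ; zero; suc; _+_; _*_; NonZero)
open import Data.Nat.DivMod using (_%_)
open import Data.Nat.Properties using (_≟_)
open import Data.Fin using (Fin; toℕ)
open import Data.List using (List; []; _∷_; map; concatMap; upTo; length; filter)
open import Data.Vec using (Vec; tabulate)

-- Letters of Σ_k are represented by natural numbers 0,…,k-1.

σ : (k : ℕ) → .{{_ : NonZero k}} → ℕ → List ℕ
σ k i = map (λ j → (i + j) % k) (upTo k)

σ* : (k : ℕ) → .{{_ : NonZero k}} → List ℕ → List ℕ
σ* k = concatMap (σ k)

σ^ : (k : ℕ) → .{{_ : NonZero k}} → ℕ → List ℕ
σ^ k zero    = 0 ∷ []
σ^ k (suc m) = σ* k (σ^ k m)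

nth : List ℕ → ℕ → ℕ
nth []       _       = 0
nth (x ∷ xs) zero    = x
nth (x ∷ xs) (suc n) = nth xs n

-- The generalized Thue–Morse sequence t^(k) = σ_k^∞(0):
-- its n-th letter is the n-th letter of σ_k^(n+1)(0), which (for k ≥ 2)
-- has length k^(n+1) > n and is a prefix of the fixed point.
tm : (k : ℕ) → .{{_ : NonZero k}} → ℕ → ℕ
tm k n = nth (σ^ k (suc n)) n

factor : (k : ℕ) → .{{_ : NonZero k}} → ℕ → ℕ → List ℕ
factor k i n = map (λ j → tm k (i + j)) (upTo n)

occ : ℕ → List ℕ → ℕ
occ a v = length (filter (_≟ a) v)

parikh : (k : ℕ) → List ℕ → Vec ℕ k
parikh k v = tabulate (λ (a : Fin k) → occ (toℕ a) v)

{-# OPTIONS --safe #-}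
module Submission where

-- Let t = t^(k); then t_i ≡ t_{⌊i/k⌋} + i (mod k).  Summing over the factor of length n at
-- position i, the cyclic differences of its Parikh vector are
--   |v|_y − |v|_{y−1} = [p = y] + [q = y] − [u = y] − [w = y],
--   p = t_{⌊(i+n)/k⌋},  q = t_i,  u = t_{i+n},  w = t_{⌊i/k⌋},
-- and together with the length n they determine the vector.  Always p + q + n ≡ u + w (mod k);
-- conversely every such quadruple occurs, because for m ≥ 1 the pair (t_Q , t_{Q+m}) takes all
-- values.  So one counts differences {p,q} − {u,w} of 2-element multisets with this balance.
-- The disjoint pairs are counted by Σ_c M_c M_{c+n} minus the non-disjoint ones, where M_c is
-- the number of 2-element multisets with sum c mod k; the non-disjoint pairs number k² and
-- collapse to k differences of two letters if k ∤ n, and number Σ_c M_c and collapse to 0 if k ∣ n.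

open import Defs
open import Data.Nat
open import Data.Nat.DivMod
open import Data.Nat.Divisibility using (divides)
open import Data.Nat.Induction using (<-rec)
open import Data.Nat.Properties
open import Data.Nat.Tactic.RingSolver using (solve-∀)
open import Data.Bool using (true; false; if_then_else_)
open import Data.Fin using (toℕ; fromℕ<)
open import Data.Fin.Properties using (toℕ<n; toℕ-fromℕ<)
open import Data.Vec using (Vec; lookup)
open import Data.Vec.Properties using (lookup∘tabulate; tabulate-cong)
open import Data.List using (List; []; _∷_; [_]; _++_; map; concatMap; upTo; applyUpTo; length; filter; cartesianProduct)
open import Data.List.Properties using (length-++; length-map; length-upTo; map-upTo; concatMap-++; ++-identityʳ; upTo-∷ʳ)
open import Data.List.Membership.Propositional using (_∈_; find; lose)
open import Data.List.Membership.Propositional.Properties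
open import Data.List.Membership.Propositional.Properties.WithK using (unique∧set⇒bag)
open import Data.List.Relation.Binary.BagAndSetEquality using (∼bag⇒↭)
open import Data.List.Relation.Binary.Permutation.Propositional.Properties using (↭-length)
open import Data.List.Relation.Unary.All as All using ([]; _∷_)
open import Data.List.Relation.Unary.AllPairs using ([]; _∷_)
open import Data.List.Relation.Unary.Any using (here; there)
open import Data.List.Relation.Unary.Unique.Propositional using (Unique)
import Data.List.Relation.Unary.Unique.Propositional.Properties as Unique
open import Data.Product using (Σ; ∃; _×_; _,_; proj₁; proj₂)
open import Data.Product.Properties using (,-injective)
open import Data.Sum as Sum using (_⊎_; inj₁; inj₂)
open import Function using (_∘_)
open import Function.Bundles using (_⇔_; mk⇔)
open import Relation.Binary.Bundles using (Setoid)
open import Relation.Binary.PropositionalEquality hiding ([_])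
import Relation.Binary.Reasoning.Setoid as SetoidReasoning
open import Relation.Nullary using (¬_; yes; no; does; contradiction; ¬?; _⊎-dec_)
open import Relation.Nullary.Decidable using (dec-true; dec-false)
open import Relation.Unary using (Decidable)

-- Only four letters govern the increments because every aligned block σ_k(a) contains each letter
-- once: just the incomplete blocks at the two ends of a factor disturb a constant count. The
-- hypothesis n ≥ k makes ⌊i/k⌋ < ⌊(i+n)/k⌋ for every i, so w and p are letters at a positive
-- distance and can be prescribed independently, while i mod k adjusts q and the balance yields u.
-- Disjoint pairs serve as representatives because a formal difference of multisets has exactly one
-- reduced form, in which nothing cancels. If a letter does cancel, the balance leaves q - (q + n):
-- these are k differences when k ∤ n and the zero difference when k ∣ n, which is the origin of the
-- summands k and 1 in the formulas. Parity enters through M_c. For odd k it is constantly (k +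
-- 1)/2; for even k it is k/2 + 1 or k/2 as c is even or odd, so it matters whether c and c + n have
-- the same parity. Since ℕ has no true subtraction, identities between differences are stated with
-- the negative terms moved across.

module Modular (k : ℕ) .{{_ : NonZero k}} where

  infix 4 _≈_

  -- A record rather than the bare equation: unification recovers `a` and `b` from `a ≈ b`, but not
  -- from an equation of remainders.
  record _≈_ (a b : ℕ) : Set where
    constructor mk
    field residue : a % k ≡ b % k
  open _≈_ public

  ≈-refl : ∀ {a} → a ≈ a
  ≈-refl = mk refl

  ≈-sym : ∀ {a b} → a ≈ b → b ≈ a
  ≈-sym (mk p) = mk (sym p)

  ≈-trans : ∀ {a b c} → a ≈ b → b ≈ c → a ≈ c
  ≈-trans (mk p) (mk q) = mk (trans p q)

  ≈-reflexive : ∀ {a b} → a ≡ b → a ≈ b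
  ≈-reflexive p = mk (cong (_% k) p)

  ≈-setoid : Setoid _ _
  ≈-setoid = record
    { Carrier = ℕ ; _≈_ = _≈_
    ; isEquivalence = record { refl = ≈-refl ; sym = ≈-sym ; trans = ≈-trans } }

  module ≈-Reasoning = SetoidReasoning ≈-setoid

  %-≈ : ∀ a → a % k ≈ a
  %-≈ a = mk (m%n%n≡m%n a k)

  +-cong-≈ : ∀ {a b c d} → a ≈ b → c ≈ d → a + c ≈ b + d
  +-cong-≈ {a} {b} {c} {d} (mk p) (mk q) = mk (begin
    (a + c) % k              ≡⟨ %-distribˡ-+ a c k ⟩
    (a % k + c % k) % k      ≡⟨ cong₂ (λ x y → (x + y) % k) p q ⟩
    (b % k + d % k) % k      ≡⟨ %-distribˡ-+ b d k ⟨
    (b + d) % k              ∎)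
    where
    open ≡-Reasoning

  +-k*-≈ : ∀ a m → a + m * k ≈ a
  +-k*-≈ a m = mk ([m+kn]%n≡m%n a m k)

  +-k-≈ : ∀ a → a + k ≈ a
  +-k-≈ a = mk ([m+n]%n≡m%n a k)

  -- Stands for -c modulo k inside ℕ, because c + (k - 1) c is a multiple of k.
  neg : ℕ → ℕ
  neg c = pred k * c

  +-neg-≈ : ∀ x c → (x + c) + neg c ≈ x
  +-neg-≈ x c = ≈-trans (≈-reflexive (trans (+-assoc x c _)
    (cong (x +_) (trans (cong (_* c) (suc-pred k)) (*-comm k c))))) (+-k*-≈ x c)

  +-cancelʳ-≈ : ∀ {a b} c → a + c ≈ b + c → a ≈ b
  +-cancelʳ-≈ {a} {b} c p = begin
    a                ≈⟨ +-neg-≈ a c ⟨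
    a + c + neg c    ≈⟨ +-cong-≈ p ≈-refl ⟩
    b + c + neg c    ≈⟨ +-neg-≈ b c ⟩
    b                ∎
    where
    open ≈-Reasoning

  +-cancelˡ-≈ : ∀ {a b} c → c + a ≈ c + b → a ≈ b
  +-cancelˡ-≈ {a} {b} c p = +-cancelʳ-≈ c
    (≈-trans (≈-reflexive (+-comm a c)) (≈-trans p (≈-reflexive (+-comm c b))))

  ≈⇒≡ : ∀ {a b} → a < k → b < k → a ≈ b → a ≡ b
  ≈⇒≡ a<k b<k (mk p) = trans (sym (m<n⇒m%n≡m a<k)) (trans p (m<n⇒m%n≡m b<k))

  ≈⇒≡% : ∀ {a b} → a < k → a ≈ b → a ≡ b % k
  ≈⇒≡% a<k (mk p) = trans (sym (m<n⇒m%n≡m a<k)) p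

  [s+qk]/k : ∀ {s} q → s < k → (s + q * k) / k ≡ q
  [s+qk]/k {s} q s<k = *-cancelʳ-≡ _ _ k (+-cancelˡ-≡ s _ _ (begin
    s + (s + q * k) / k * k                  ≡⟨ cong (_+ (s + q * k) / k * k) r ⟨
    (s + q * k) % k + (s + q * k) / k * k    ≡⟨ m≡m%n+[m/n]*n (s + q * k) k ⟨
    s + q * k                                ∎))
    where
    open ≡-Reasoning
    r : (s + q * k) % k ≡ s
    r = trans ([m+kn]%n≡m%n s q k) (m<n⇒m%n≡m s<k)

  [s+qk]%k : ∀ {s} q → s < k → (s + q * k) % k ≡ s
  [s+qk]%k {s} q s<k = trans ([m+kn]%n≡m%n s q k) (m<n⇒m%n≡m s<k)

  [i+qk]/k : ∀ i q → (i + q * k) / k ≡ i / k + q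
  [i+qk]/k i q = trans (cong (_/ k) eq) ([s+qk]/k (i / k + q) (m%n<n i k))
    where
    eq : i + q * k ≡ i % k + (i / k + q) * k
    eq = trans (cong (_+ q * k) (m≡m%n+[m/n]*n i k))
      (lem (i % k) (i / k) q k)
      where
      lem : ∀ a b c d → a + b * d + c * d ≡ a + (b + c) * d
      lem = solve-∀

-- Letters of the fixed point: the digit recurrence and the pairs at a given distance.

nth-++ˡ : ∀ xs ys {i} → i < length xs → nth (xs ++ ys) i ≡ nth xs i
nth-++ˡ (x ∷ xs) ys {zero} _ = refl
nth-++ˡ (x ∷ xs) ys {suc i} (s≤s p) = nth-++ˡ xs ys p

nth-++ʳ : ∀ xs ys i → nth (xs ++ ys) (length xs + i) ≡ nth ys i
nth-++ʳ [] ys i = refl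
nth-++ʳ (x ∷ xs) ys i = nth-++ʳ xs ys i

nth-applyUpTo : ∀ f {n i} → i < n → nth (applyUpTo f n) i ≡ f i
nth-applyUpTo f {suc n} {zero} _ = refl
nth-applyUpTo f {suc n} {suc i} (s≤s p) = nth-applyUpTo (λ j → f (suc j)) p

n<m^n : ∀ {m} → 2 ≤ m → ∀ n → n < m ^ n
n<m^n 2≤m zero = s≤s z≤n
n<m^n {m} 2≤m (suc n) = begin-strict
  suc n              <⟨ s≤s (n<m^n 2≤m n) ⟩
  1 + m ^ n          ≤⟨ +-monoˡ-≤ (m ^ n) (≤-trans (s≤s z≤n) (n<m^n 2≤m n)) ⟩
  m ^ n + m ^ n      ≡⟨ cong (m ^ n +_) (+-identityʳ (m ^ n)) ⟨
  2 * m ^ n          ≤⟨ *-monoˡ-≤ (m ^ n) 2≤m ⟩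
  m * m ^ n          ∎
  where
  open ≤-Reasoning

module ThueMorse (k : ℕ) .{{_ : NonZero k}} (2≤k : 2 ≤ k) where
  open Modular k

  t : ℕ → ℕ
  t = tm k

  0<k : 0 < k
  0<k = ≤-trans (s≤s z≤n) 2≤k

  length-σ : ∀ x → length (σ k x) ≡ k
  length-σ x = trans (length-map _ (upTo k)) (length-upTo k)

  nth-σ : ∀ x {s} → s < k → nth (σ k x) s ≡ (x + s) % k
  nth-σ x {s} s<k = trans (cong (λ l → nth l s) (map-upTo _ k)) (nth-applyUpTo _ s<k)

  length-σ* : ∀ xs → length (σ* k xs) ≡ length xs * k
  length-σ* [] = refl
  length-σ* (x ∷ xs) = trans (length-++ (σ k x)) (cong₂ _+_ (length-σ x) (length-σ* xs))

  length-σ^ : ∀ m → length (σ^ k m) ≡ k ^ m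
  length-σ^ zero = refl
  length-σ^ (suc m) = trans (length-σ* (σ^ k m))
    (trans (cong (_* k) (length-σ^ m)) (*-comm (k ^ m) k))

  nth-σ* : ∀ xs {q s} → q < length xs → s < k → nth (σ* k xs) (s + q * k) ≡ (nth xs q + s) % k
  nth-σ* (x ∷ xs) {zero} {s} _ s<k = begin
    nth (σ k x ++ σ* k xs) (s + 0)  ≡⟨ cong (nth (σ k x ++ σ* k xs)) (+-identityʳ s) ⟩
    nth (σ k x ++ σ* k xs) s        ≡⟨ nth-++ˡ (σ k x) _ (subst (s <_) (sym (length-σ x)) s<k) ⟩
    nth (σ k x) s                   ≡⟨ nth-σ x s<k ⟩
    (x + s) % k                     ∎
    where
    open ≡-Reasoning
  nth-σ* (x ∷ xs) {suc q} {s} (s≤s q<) s<k = begin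
    nth (σ k x ++ σ* k xs) (s + (k + q * k))
      ≡⟨ cong (nth (σ k x ++ σ* k xs)) (trans (swap s k (q * k))
           (cong (_+ (s + q * k)) (sym (length-σ x)))) ⟩
    nth (σ k x ++ σ* k xs) (length (σ k x) + (s + q * k))
      ≡⟨ nth-++ʳ (σ k x) _ (s + q * k) ⟩
    nth (σ* k xs) (s + q * k)
      ≡⟨ nth-σ* xs q< s<k ⟩
    (nth xs q + s) % k ∎
    where
    open ≡-Reasoning
    swap : ∀ a b c → a + (b + c) ≡ b + (a + c)
    swap = solve-∀

  i/k<k^m : ∀ m {i} → i < k ^ suc m → i / k < k ^ m
  i/k<k^m m {i} p = m<n*o⇒m/o<n (subst (i <_) (*-comm k (k ^ m)) p)

  nth-σ^ : ∀ m {i} → i < k ^ suc m → nth (σ^ k (suc m)) i ≡ (nth (σ^ k m) (i / k) + i % k) % k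
  nth-σ^ m {i} p = trans (cong (nth (σ^ k (suc m))) (m≡m%n+[m/n]*n i k))
    (nth-σ* (σ^ k m) (subst (i / k <_) (sym (length-σ^ m)) (i/k<k^m m p)) (m%n<n i k))

  -- Position i of a level comes from position `i / k` of the level below, so induction descends to
  -- level 0, where it remains that σ_k(0) begins with 0.
  σ^-prefix : ∀ m {i} → i < k ^ m → nth (σ^ k (suc m)) i ≡ nth (σ^ k m) i
  σ^-prefix zero {zero} p = trans (nth-σ* (0 ∷ []) {0} {0} (s≤s z≤n) 0<k) (m<n⇒m%n≡m 0<k)
  σ^-prefix zero {suc i} (s≤s ())
  σ^-prefix (suc m) {i} p = begin
    nth (σ^ k (2 + m)) i                          ≡⟨ nth-σ^ (suc m) (≤-trans p (^-monoʳ-≤ k (n≤1+n (suc m)))) ⟩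
    (nth (σ^ k (suc m)) (i / k) + i % k) % k      ≡⟨ cong (λ z → (z + i % k) % k) (σ^-prefix m (i/k<k^m m p)) ⟩
    (nth (σ^ k m) (i / k) + i % k) % k            ≡⟨ nth-σ^ m p ⟨
    nth (σ^ k (suc m)) i                          ∎
    where
    open ≡-Reasoning

  σ^-prefix* : ∀ d m {i} → i < k ^ m → nth (σ^ k (d + m)) i ≡ nth (σ^ k m) i
  σ^-prefix* zero m p = refl
  σ^-prefix* (suc d) m p = trans (σ^-prefix (d + m) (≤-trans p (^-monoʳ-≤ k (m≤n+m m d)))) (σ^-prefix* d m p)

  -- The levels `m` and `suc i` come in no fixed order, so both are compared with the level
  -- `m + suc i` above them.
  tm≡nth-σ^ : ∀ m {i} → i < k ^ m → t i ≡ nth (σ^ k m) i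
  tm≡nth-σ^ m {i} p = begin
    nth (σ^ k (suc i)) i         ≡⟨ σ^-prefix* m (suc i) (≤-trans (n<m^n 2≤k i) (^-monoʳ-≤ k (n≤1+n i))) ⟨
    nth (σ^ k (m + suc i)) i     ≡⟨ cong (λ z → nth (σ^ k z) i) (+-comm m (suc i)) ⟩
    nth (σ^ k (suc i + m)) i     ≡⟨ σ^-prefix* (suc i) m p ⟩
    nth (σ^ k m) i               ∎
    where
    open ≡-Reasoning

  t-rec : ∀ i → t i ≡ (t (i / k) + i % k) % k
  t-rec i = trans (nth-σ^ i i<)
    (cong (λ z → (z + i % k) % k) (sym (tm≡nth-σ^ i (≤-trans (s≤s (m/n≤m i k)) (n<m^n 2≤k i)))))
    where
    i< : i < k ^ suc i
    i< = ≤-trans (n<m^n 2≤k i) (^-monoʳ-≤ k (n≤1+n i))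

  t<k : ∀ i → t i < k
  t<k i = subst (_< k) (sym (t-rec i)) (m%n<n _ k)

  t-digit : ∀ {s} q → s < k → t (s + q * k) ≈ t q + s
  t-digit {s} q s<k = ≈-trans (≈-reflexive (trans (t-rec (s + q * k))
    (cong₂ (λ a b → (t a + b) % k) ([s+qk]/k q s<k) ([s+qk]%k q s<k)))) (%-≈ _)

  t-≈ : ∀ i → t i ≈ t (i / k) + i % k
  t-≈ i = ≈-trans (≈-reflexive (t-rec i)) (%-≈ _)

  -- Lowering the first letter: a position ending in the digit k − 1 turns (t_Q , t_{Q+1}) into (t_Q − 1 , t_{Q+1}).
  adjacent : ∀ j b → ∃ λ Q → (t Q + suc j ≈ b) × (t (suc Q) ≈ b)
  adjacent zero b = Q , ≈-trans (≈-reflexive (+-comm (t Q) 1)) (≈-trans (≈-sym tQ') tQ'≈b) , tQ'≈b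
    where
    -- `d` is b - 1 modulo k. A one-digit position carries itself as its letter, so the positions dk
    -- and dk + 1 carry b - 1 and b.
    d = (b + pred k) % k
    Q = d * k
    1+pred : pred k + 1 ≡ k
    1+pred = trans (+-comm (pred k) 1) (suc-pred k)
    d≈ : t d ≈ d
    d≈ = ≈-trans (t-≈ d) (+-cong-≈ (≈-reflexive (trans (cong t (m<n⇒m/n≡0 d<k)) t0)) (%-≈ d))
      where
      d<k = m%n<n (b + pred k) k
      t0 : t 0 ≡ 0
      t0 = tm≡nth-σ^ 0 (s≤s z≤n)
    tQ : t Q ≈ t d
    tQ = ≈-trans (t-digit d 0<k) (≈-reflexive (+-identityʳ (t d)))
    tQ' : t (suc Q) ≈ 1 + t Q
    tQ' = ≈-trans (t-digit d 2≤k) (≈-trans (≈-reflexive (+-comm (t d) 1)) (+-cong-≈ (≈-refl {1}) (≈-sym tQ)))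
    tQ'≈b : t (suc Q) ≈ b
    tQ'≈b = begin
      t (suc Q)           ≈⟨ t-digit d 2≤k ⟩
      t d + 1             ≈⟨ +-cong-≈ (≈-trans d≈ (%-≈ _)) ≈-refl ⟩
      b + pred k + 1      ≡⟨ trans (+-assoc b _ 1) (cong (b +_) 1+pred) ⟩
      b + k               ≈⟨ +-k-≈ b ⟩
      b                   ∎
      where
      open ≈-Reasoning
  adjacent (suc j) b with Q , p , q ← adjacent j b = Q' , p' , q'
    where
    open ≈-Reasoning
    Q' = pred k + Q * k
    pred<k : pred k < k
    pred<k = ≤-reflexive (suc-pred k)
    p' : t Q' + suc (suc j) ≈ b
    p' = begin
      t Q' + suc (suc j)              ≈⟨ +-cong-≈ (t-digit Q pred<k) ≈-refl ⟩
      t Q + pred k + suc (suc j)      ≡⟨ lem (t Q) (pred k) (suc j) ⟩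
      t Q + suc j + suc (pred k)      ≡⟨ cong (t Q + suc j +_) (suc-pred k) ⟩
      t Q + suc j + k                 ≈⟨ +-k-≈ _ ⟩
      t Q + suc j                     ≈⟨ p ⟩
      b                               ∎
      where
      lem : ∀ a b c → a + b + (1 + c) ≡ a + c + (1 + b)
      lem = solve-∀
    q' : t (suc Q') ≈ b
    q' = begin
      t (suc Q')          ≡⟨ cong (λ z → t (z + Q * k)) (suc-pred k) ⟩
      t (0 + suc Q * k)   ≈⟨ t-digit (suc Q) 0<k ⟩
      t (suc Q) + 0       ≡⟨ +-identityʳ _ ⟩
      t (suc Q)           ≈⟨ q ⟩
      b                   ∎

  -- Strong induction on the distance. For Q = (k - 1) + kX the quotients of Q and Q + m by k are X
  -- and X + ⌈m/k⌉, and the last digits only shift the two letters by known amounts. The last digit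
  -- k - 1 keeps the new distance positive, and ⌈m/k⌉ < m as soon as m ≥ 2. Distance 1 reproduces
  -- itself, hence the separate treatment by `adjacent`.
  pairs : ∀ m → 1 ≤ m → ∀ a b → ∃ λ Q → (t Q ≈ a) × (t (Q + m) ≈ b)
  pairs = <-rec _ step
    where
    open ≈-Reasoning
    step : ∀ m → (∀ {m'} → m' < m → 1 ≤ m' → ∀ a b → ∃ λ Q → (t Q ≈ a) × (t (Q + m') ≈ b)) →
           1 ≤ m → ∀ a b → ∃ λ Q → (t Q ≈ a) × (t (Q + m) ≈ b)
    -- The drop `suc j` asked of `adjacent` has to be b - a modulo k; `pred k` plays the part of -1.
    step 1 _ _ a b with Q , p , q ← adjacent (b + neg a + pred k) b =
      Q , +-cancelʳ-≈ (suc (b + neg a + pred k)) (≈-trans p (≈-sym c)) ,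
      ≈-trans (≈-reflexive (cong t (+-comm Q 1))) q
      where
      lem : ∀ a b c d → a + (1 + (b + c + d)) ≡ b + a + c + (1 + d)
      lem = solve-∀
      c : a + suc (b + neg a + pred k) ≈ b
      c = begin
        a + suc (b + neg a + pred k)        ≡⟨ lem a b (neg a) (pred k) ⟩
        b + a + neg a + suc (pred k)        ≡⟨ cong (b + a + neg a +_) (suc-pred k) ⟩
        b + a + neg a + k                   ≈⟨ +-k-≈ _ ⟩
        b + a + neg a                       ≈⟨ +-neg-≈ b a ⟩
        b                                   ∎
    step m@(suc (suc m₀)) rec _ a b = Q , p' , q'
      where
      -- Here this is the offset of `Q + m` from `X * k`: its quotient by k is the shorter distance,
      -- its remainder the last digit of `Q + m`.
      numPairs = pred k + m
      ge : k ≤ numPairs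
      ge = ≤-trans (≤-reflexive (trans (sym (suc-pred k)) (+-comm 1 (pred k)))) (+-monoʳ-≤ (pred k) (s≤s z≤n))
      1≤pred : 1 ≤ pred k
      1≤pred = ≤-pred (subst (2 ≤_) (sym (suc-pred k)) 2≤k)
      -- Here m ≥ 2 enters: m k = m + m (k - 1), and m (k - 1) ≥ 2 (k - 1) ≥ k.
      lt : numPairs < m * k
      lt = ≤-trans (s≤s (≤-reflexive (+-comm (pred k) m)))
        (≤-trans (≤-trans (≤-reflexive (sym (+-suc m (pred k)))) (+-monoʳ-≤ m
          (≤-trans (+-monoˡ-≤ (pred k) 1≤pred) (+-monoʳ-≤ (pred k) (m≤m+n (pred k) (m₀ * pred k))))))
        (≤-reflexive (trans (sym (*-suc m (pred k))) (cong (m *_) (suc-pred k)))))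
      rec' : ∃ λ X → (t X ≈ a + 1) × (t (X + numPairs / k) ≈ b + neg (numPairs % k))
      rec' = rec (m<n*o⇒m/o<n lt) (m≥n⇒m/n>0 ge) (a + 1) (b + neg (numPairs % k))
      X = proj₁ rec'
      Q = pred k + X * k
      p' : t Q ≈ a
      p' = begin
        t Q              ≈⟨ t-digit X (≤-reflexive (suc-pred k)) ⟩
        t X + pred k     ≈⟨ +-cong-≈ (proj₁ (proj₂ rec')) ≈-refl ⟩
        a + 1 + pred k   ≡⟨ trans (+-assoc a 1 _) (cong (a +_) (suc-pred k)) ⟩
        a + k            ≈⟨ +-k-≈ a ⟩
        a                ∎
      lem : ∀ s x y k → s + x * k + y ≡ (s + y) + x * k
      lem = solve-∀
      lem' : ∀ s x y k → s + x * k + y * k ≡ s + (y + x) * k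
      lem' = solve-∀
      lem'' : ∀ x y z → x + y + z ≡ x + z + y
      lem'' = solve-∀
      q' : t (Q + m) ≈ b
      q' = begin
        t (Q + m)                            ≡⟨ cong t (lem (pred k) X m k) ⟩
        t (numPairs + X * k)                        ≡⟨ cong (λ z → t (z + X * k)) (m≡m%n+[m/n]*n numPairs k) ⟩
        t (numPairs % k + numPairs / k * k + X * k)        ≡⟨ cong t (lem' (numPairs % k) (numPairs / k) X k) ⟩
        t (numPairs % k + (X + numPairs / k) * k)          ≈⟨ t-digit (X + numPairs / k) (m%n<n numPairs k) ⟩
        t (X + numPairs / k) + numPairs % k                ≈⟨ +-cong-≈ (proj₂ (proj₂ rec')) ≈-refl ⟩
        b + neg (numPairs % k) + numPairs % k              ≡⟨ lem'' b (neg (numPairs % k)) (numPairs % k) ⟩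
        b + numPairs % k + neg (numPairs % k)              ≈⟨ +-neg-≈ b (numPairs % k) ⟩
        b                                    ∎

  t-≈-i : ∀ i → t i ≈ t (i / k) + i
  t-≈-i i = ≈-trans (t-≈ i) (+-cong-≈ (≈-refl {t (i / k)}) (%-≈ i))

  -- The recurrence t_i ≡ t_{⌊i/k⌋} + i at `i + n`, minus the same at `i`.
  balanced : ∀ i n → t ((i + n) / k) + t i + n ≈ t (i + n) + t (i / k)
  balanced i n = begin
    t ((i + n) / k) + t i + n             ≈⟨ +-cong-≈ (+-cong-≈ (≈-refl {t ((i + n) / k)}) (t-≈-i i)) ≈-refl ⟩
    t ((i + n) / k) + (t (i / k) + i) + n ≡⟨ lem (t ((i + n) / k)) (t (i / k)) i n ⟩
    t ((i + n) / k) + (i + n) + t (i / k) ≈⟨ +-cong-≈ (t-≈-i (i + n)) ≈-refl ⟨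
    t (i + n) + t (i / k)                 ∎
    where
    open ≈-Reasoning
    lem : ∀ a b c d → a + (b + c) + d ≡ a + (c + d) + b
    lem = solve-∀

  -- The last digit `s` of i is forced to be q - u. Whatever it is, n ≥ k makes `(s + n) / k`
  -- positive, so `pairs` can prescribe both u and p; w then follows from `balanced`. Note the
  -- naming: here `u` is the letter at `i / k` and `w` the one at `i + n`.
  realise : ∀ {n} → k ≤ n → ∀ p q u w → p + q + n ≈ w + u →
            ∃ λ i → (t ((i + n) / k) ≈ p) × (t i ≈ q) × (t (i + n) ≈ w) × (t (i / k) ≈ u)
  realise {n} k≤n p q u w bal = i , tp , tq , tw , tu
    where
    s = (q + neg u) % k
    s<k = m%n<n (q + neg u) k
    ge : k ≤ s + n
    ge = ≤-trans k≤n (m≤n+m n s)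
    Q = proj₁ (pairs ((s + n) / k) (m≥n⇒m/n>0 ge) u p)
    i = s + Q * k
    tQ : t Q ≈ u
    tQ = proj₁ (proj₂ (pairs ((s + n) / k) (m≥n⇒m/n>0 ge) u p))
    lem : ∀ a b c → a + b + c ≡ a + c + b
    lem = solve-∀
    tp : t ((i + n) / k) ≈ p
    tp = ≈-trans (≈-reflexive (cong t (trans (trans (cong (_/ k) (lem s (Q * k) n)) ([i+qk]/k (s + n) Q))
      (+-comm ((s + n) / k) Q)))) (proj₂ (proj₂ (pairs ((s + n) / k) (m≥n⇒m/n>0 ge) u p)))
    tu : t (i / k) ≈ u
    tu = ≈-trans (≈-reflexive (cong t ([s+qk]/k Q s<k))) tQ
    tq : t i ≈ q
    tq = ≈-trans (t-digit Q s<k) (≈-trans (+-cong-≈ tQ (%-≈ _))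
      (≈-trans (≈-reflexive (trans (sym (+-assoc u q _)) (cong (_+ neg u) (+-comm u q)))) (+-neg-≈ q u)))
    tw : t (i + n) ≈ w
    tw = +-cancelʳ-≈ u (begin
      t (i + n) + u               ≈⟨ +-cong-≈ ≈-refl (≈-sym tu) ⟩
      t (i + n) + t (i / k)       ≈⟨ balanced i n ⟨
      t ((i + n) / k) + t i + n   ≈⟨ +-cong-≈ (+-cong-≈ tp tq) ≈-refl ⟩
      p + q + n                   ≈⟨ bal ⟩
      w + u                       ∎)
      where
      open ≈-Reasoning

-- Multiplicities, finite sums and formal differences of pairs.

δ : ℕ → ℕ → ℕ
δ x y = if does (x ≟ y) then 1 else 0

δ-≡ : ∀ {x y} → x ≡ y → δ x y ≡ 1
δ-≡ {x} {y} p rewrite dec-true (x ≟ y) p = refl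

δ-≢ : ∀ {x y} → x ≢ y → δ x y ≡ 0
δ-≢ {x} {y} p rewrite dec-false (x ≟ y) p = refl

δ-cong : ∀ {a b c d} → (a ≡ b → c ≡ d) → (c ≡ d → a ≡ b) → δ a b ≡ δ c d
δ-cong {a} {b} f g with a ≟ b
... | yes p = trans (δ-≡ p) (sym (δ-≡ (f p)))
... | no ¬p = trans (δ-≢ ¬p) (sym (δ-≢ (λ q → ¬p (g q))))

occ-∷ : ∀ y x v → occ y (x ∷ v) ≡ δ x y + occ y v
occ-∷ y x v with does (x ≟ y)
... | true  = refl
... | false = refl

sumTo : (ℕ → ℕ) → ℕ → ℕ
sumTo f zero    = 0
sumTo f (suc m) = sumTo f m + f m

sumTo-cong : ∀ {f g} m → (∀ x → x < m → f x ≡ g x) → sumTo f m ≡ sumTo g m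
sumTo-cong zero    p = refl
sumTo-cong (suc m) p = cong₂ _+_ (sumTo-cong m (λ x x< → p x (m<n⇒m<1+n x<))) (p m ≤-refl)

sumTo-+ : ∀ f g m → sumTo (λ x → f x + g x) m ≡ sumTo f m + sumTo g m
sumTo-+ f g zero    = refl
sumTo-+ f g (suc m) = trans (cong (_+ (f m + g m)) (sumTo-+ f g m)) (lem (sumTo f m) (sumTo g m) (f m) (g m))
  where
  lem : ∀ a b c d → a + b + (c + d) ≡ a + c + (b + d)
  lem = solve-∀

sumTo-const : ∀ c m → sumTo (λ _ → c) m ≡ m * c
sumTo-const c zero    = refl
sumTo-const c (suc m) = trans (cong (_+ c) (sumTo-const c m)) (+-comm (m * c) c)

sumTo-δ≡0 : ∀ {x} m → m ≤ x → sumTo (δ x) m ≡ 0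
sumTo-δ≡0 zero    p = refl
sumTo-δ≡0 (suc m) p = cong₂ _+_ (sumTo-δ≡0 m (<⇒≤ p)) (δ-≢ (≢-sym (<⇒≢ p)))

sumTo-δ : ∀ {x} m → x < m → sumTo (δ x) m ≡ 1
sumTo-δ {x} (suc m) (s≤s x≤m) with x ≟ m
... | yes refl = cong₂ _+_ (sumTo-δ≡0 m ≤-refl) (δ-≡ {m} refl)
... | no x≢m   = cong₂ _+_ (sumTo-δ m (≤∧≢⇒< x≤m x≢m)) (δ-≢ x≢m)

-- The two sequences differ by a constant, which the equal sums force to be zero.
increments-sum-unique : ∀ {f g} m → (∀ x → suc x < m → f (suc x) + g x ≡ g (suc x) + f x) →
  sumTo f m ≡ sumTo g m → ∀ x → x < m → f x ≡ g x
increments-sum-unique {f} {g} zero    _ _ x ()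
increments-sum-unique {f} {g} m@(suc _) d s x x<m =
  +-cancelʳ-≡ (g 0) (f x) (g x) (trans (off x x<m) (cong (g x +_) f0≡g0))
  where
  open ≡-Reasoning
  lem : ∀ a b c → a + b + c ≡ a + c + b
  lem = solve-∀
  off : ∀ x → x < m → f x + g 0 ≡ g x + f 0
  off zero    _  = +-comm (f 0) (g 0)
  off (suc x) p = +-cancelʳ-≡ (g x) _ _ (begin
    f (suc x) + g 0 + g x   ≡⟨ lem (f (suc x)) (g 0) (g x) ⟩
    f (suc x) + g x + g 0   ≡⟨ cong (_+ g 0) (d x p) ⟩
    g (suc x) + f x + g 0   ≡⟨ +-assoc (g (suc x)) (f x) (g 0) ⟩
    g (suc x) + (f x + g 0) ≡⟨ cong (g (suc x) +_) (off x (<⇒≤ p)) ⟩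
    g (suc x) + (g x + f 0) ≡⟨ cong (g (suc x) +_) (+-comm (g x) (f 0)) ⟩
    g (suc x) + (f 0 + g x) ≡⟨ +-assoc (g (suc x)) (f 0) (g x) ⟨
    g (suc x) + f 0 + g x   ∎)
  f0≡g0 : f 0 ≡ g 0
  f0≡g0 = sym (*-cancelˡ-≡ (g 0) (f 0) m (+-cancelˡ-≡ (sumTo f m) _ _ (begin
    sumTo f m + m * g 0               ≡⟨ cong (sumTo f m +_) (sumTo-const (g 0) m) ⟨
    sumTo f m + sumTo (λ _ → g 0) m   ≡⟨ sumTo-+ f (λ _ → g 0) m ⟨
    sumTo (λ x → f x + g 0) m         ≡⟨ sumTo-cong m off ⟩
    sumTo (λ x → g x + f 0) m         ≡⟨ sumTo-+ g (λ _ → f 0) m ⟩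
    sumTo g m + sumTo (λ _ → f 0) m   ≡⟨ cong₂ _+_ (sym s) (sumTo-const (f 0) m) ⟩
    sumTo f m + m * f 0               ∎)))

-- A `Pair` stands for the 2-element multiset of its entries, and a `Quad` (P , U) for the formal
-- difference P - U.
Pair Quad : Set
Pair = ℕ × ℕ
Quad = Pair × Pair

mult : Pair → ℕ → ℕ
mult (p , q) y = δ p y + δ q y

module Cancellation (k : ℕ) where

  infix 4 _∼_
  -- Equality of the formal differences P - U and P' - U' on the letters below k, with each
  -- subtraction moved to the other side.
  record _∼_ (a b : Quad) : Set where
    constructor mk∼
    field at : ∀ y → y < k → mult (proj₁ a) y + mult (proj₂ b) y ≡ mult (proj₁ b) y + mult (proj₂ a) y
  open _∼_ public

  ∼-sym : ∀ {a b} → a ∼ b → b ∼ a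
  ∼-sym s = mk∼ λ y y<k → sym (at s y y<k)

  ∼-trans : ∀ {a b c} → a ∼ b → b ∼ c → a ∼ c
  ∼-trans {P , U} {P' , U'} {P'' , U''} p q = mk∼ λ y y<k →
    +-cancelʳ-≡ (mult P' y + mult U' y) _ _ (lem (mult P y) (mult U y) (mult P' y) (mult U' y) (mult P'' y) (mult U'' y) (at p y y<k) (at q y y<k))
    where
    lem : ∀ a b c d g f → a + d ≡ c + b → c + f ≡ g + d → a + f + (c + d) ≡ g + b + (c + d)
    lem a b c d g f p q = trans (r₁ a f c d) (trans (cong₂ _+_ p q) (r₂ c b g d))
      where
      r₁ : ∀ a f c d → a + f + (c + d) ≡ a + d + (c + f)
      r₁ = solve-∀
      r₂ : ∀ c b g d → c + b + (g + d) ≡ g + b + (c + d)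
      r₂ = solve-∀

-- Parikh vectors and the four letters that determine them.

module Parikh (k : ℕ) .{{_ : NonZero k}} (2≤k : 2 ≤ k) where
  open Modular k
  open ThueMorse k 2≤k
  open Cancellation k

  -- Recursion on the length with a moving start: the shape needed for the induction in
  -- `cnt-increment`.
  cnt : ℕ → ℕ → ℕ → ℕ
  cnt y i zero    = 0
  cnt y i (suc m) = δ (t i) y + cnt y (suc i) m

  occ-factor : ∀ y i m → occ y (factor k i m) ≡ cnt y i m
  occ-factor y i m = trans (cong (occ y) (map-upTo _ m)) (go m i _ (λ _ → refl))
    where
    go : ∀ m i (f : ℕ → ℕ) → (∀ j → f j ≡ t (i + j)) → occ y (applyUpTo f m) ≡ cnt y i m
    go zero    i f p = refl
    go (suc m) i f p = trans (occ-∷ y (f 0) _) (cong₂ _+_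
      (cong (λ z → δ z y) (trans (p 0) (cong t (+-identityʳ i))))
      (go m (suc i) _ (λ j → trans (p (suc j)) (cong t (+-suc i j)))))

  sumTo-cnt : ∀ i m → sumTo (λ y → cnt y i m) k ≡ m
  sumTo-cnt i zero    = trans (sumTo-const 0 k) (*-zeroʳ k)
  sumTo-cnt i (suc m) = trans (sumTo-+ (δ (t i)) (λ y → cnt y (suc i) m) k)
    (cong₂ _+_ (sumTo-δ k (t<k i)) (sumTo-cnt (suc i) m))

  -- Within a block t_{i+1} = t_i + 1 and the quotient by k stays, so y at i + 1 answers to x at i.
  -- At the end of a block t_i + 1 wraps around to the first letter of that block, t_{⌊i/k⌋}, while
  -- i + 1 opens a new block and carries its first letter.
  cnt-step : ∀ i {x y} → x < k → y < k → suc x ≈ y →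
    δ (t (i / k)) y + δ (t (suc i)) y ≡ δ (t i) x + δ (t (suc i / k)) y
  cnt-step i {x} {y} x<k y<k x+1≈y with suc (i % k) ≟ k
  ... | no ≢k = trans (+-comm (δ (t q) y) _) (cong₂ _+_
        (δ-cong (λ p → ≈⇒≡ (t<k i) x<k (+-cancelˡ-≈ 1 (≈-trans (≈-sym t+1)
                         (≈-trans (≈-reflexive p) (≈-sym x+1≈y)))))
                (λ p → ≈⇒≡ (t<k (suc i)) y<k (≈-trans t+1 (≈-trans (≈-reflexive (cong suc p)) x+1≈y))))
        (cong (λ z → δ (t z) y) (sym suci/k)))
    where
    q = i / k
    s<k : suc (i % k) < k
    s<k = ≤∧≢⇒< (m%n<n i k) ≢k
    suci : suc i ≡ suc (i % k) + q * k
    suci = cong suc (m≡m%n+[m/n]*n i k)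
    suci/k : suc i / k ≡ q
    suci/k = trans (cong (_/ k) suci) ([s+qk]/k q s<k)
    t+1 : t (suc i) ≈ 1 + t i
    t+1 = ≈-trans (≈-reflexive (cong t suci)) (≈-trans (t-digit q s<k)
      (≈-trans (≈-reflexive (+-suc (t q) (i % k))) (+-cong-≈ (≈-refl {1}) (≈-sym (t-≈ i)))))
  ... | yes ≡k = cong₂ _+_
        (δ-cong (λ p → ≈⇒≡ (t<k i) x<k (+-cancelˡ-≈ 1 (≈-trans t+1
                         (≈-trans (≈-reflexive p) (≈-sym x+1≈y)))))
                (λ p → ≈⇒≡ (t<k q) y<k (≈-trans (≈-sym t+1) (≈-trans (≈-reflexive (cong suc p)) x+1≈y))))
        (cong (λ z → δ z y) (≈⇒≡ (t<k (suc i)) (t<k (suc i / k)) (begin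
          t (suc i)             ≡⟨ cong t suci ⟩
          t (0 + suc q * k)     ≈⟨ t-digit (suc q) 0<k ⟩
          t (suc q) + 0         ≡⟨ +-identityʳ _ ⟩
          t (suc q)             ≡⟨ cong t (trans (cong (_/ k) suci) ([s+qk]/k (suc q) 0<k)) ⟨
          t (suc i / k)         ∎)))
    where
    open ≈-Reasoning
    q = i / k
    suci : suc i ≡ 0 + suc q * k
    suci = trans (cong suc (m≡m%n+[m/n]*n i k)) (cong (_+ q * k) ≡k)
    t+1 : 1 + t i ≈ t q
    t+1 = begin
      1 + t i               ≈⟨ +-cong-≈ (≈-refl {1}) (t-≈ i) ⟩
      1 + (t q + i % k)     ≡⟨ +-suc (t q) (i % k) ⟨
      t q + suc (i % k)     ≡⟨ cong (t q +_) ≡k ⟩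
      t q + k               ≈⟨ +-k-≈ (t q) ⟩
      t q                   ∎

  quad : ℕ → ℕ → Quad
  quad n i = (t ((i + n) / k) , t i) , (t (i + n) , t (i / k))

  -- Induction from the front: moving the start from i to i + 1 with the end fixed alters just the
  -- two letters that belong to the left end, and `cnt-step` is exactly this change.
  cnt-increment : ∀ n i {x y} → x < k → y < k → suc x ≈ y →
    cnt y i n + mult (proj₂ (quad n i)) y ≡ cnt x i n + mult (proj₁ (quad n i)) y
  cnt-increment zero i {x} {y} x<k y<k x+1≈y rewrite +-identityʳ i = +-comm (δ (t i) y) _
  cnt-increment (suc n) i {x} {y} x<k y<k x+1≈y rewrite +-suc i n =
    +-cancelʳ-≡ (δ (t (suc i / k)) y + δ (t (suc i)) y) _ _
      (lem (δ (t i) y) (cnt y (suc i) n) _ (δ (t (i / k)) y) (δ (t (suc i / k)) y) (δ (t (suc i)) y) (δ (t i) x)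
           (cnt x (suc i) n) _
           (cnt-increment n (suc i) x<k y<k x+1≈y) (cnt-step i x<k y<k x+1≈y))
    where
    lem : ∀ a c f g g' h a' c' f' → c + (f + g') ≡ c' + (f' + h) → g + h ≡ a' + g' →
      a + c + (f + g) + (g' + h) ≡ a' + c' + (f' + a) + (g' + h)
    lem a c f g g' h a' c' f' p q = trans (r₁ a c f g g' h)
      (trans (cong₂ (λ x y → a + x + y) p q) (r₂ a c' f' h a' g'))
      where
      r₁ : ∀ a c f g g' h → a + c + (f + g) + (g' + h) ≡ a + (c + (f + g')) + (g + h)
      r₁ = solve-∀
      r₂ : ∀ a c' f' h a' g' → a + (c' + (f' + h)) + (a' + g') ≡ a' + c' + (f' + a) + (g' + h)
      r₂ = solve-∀

  module _ (n : ℕ) where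

    cnt⇒∼ : ∀ {i j} → (∀ y → y < k → cnt y i n ≡ cnt y j n) → quad n i ∼ quad n j
    cnt⇒∼ {i} {j} c = mk∼ go
      where
      go : ∀ y → y < k → mult (proj₁ (quad n i)) y + mult (proj₂ (quad n j)) y ≡ mult (proj₁ (quad n j)) y + mult (proj₂ (quad n i)) y
      go y y<k = +-cancelˡ-≡ (cnt x i n + cnt y i n) _ _
        (lem (cnt x i n) (cnt y i n) _ (mult (proj₁ (quad n i)) y) _ (mult (proj₂ (quad n j)) y)
          (cnt-increment n i x<k y<k x+1≈y)
          (trans (cong (_+ mult (proj₂ (quad n j)) y) (c y y<k)) (trans (cnt-increment n j x<k y<k x+1≈y)
            (cong (_+ mult (proj₁ (quad n j)) y) (sym (c x x<k))))))
        where
        -- The cyclic predecessor of y, so that y = 0 is covered as well.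
        x = (y + pred k) % k
        x<k = m%n<n (y + pred k) k
        x+1≈y : suc x ≈ y
        x+1≈y = ≈-trans (+-cong-≈ (≈-refl {1}) (%-≈ _)) (≈-trans (≈-reflexive
          (trans (sym (+-suc y (pred k))) (cong (y +_) (suc-pred k)))) (+-k-≈ y))
        lem : ∀ cx cy u p p' u' → cy + u ≡ cx + p → cy + u' ≡ cx + p' → cx + cy + (p + u') ≡ cx + cy + (p' + u)
        lem cx cy u p p' u' h h' = trans (r₁ cx cy p u') (trans (cong₂ _+_ (sym h) h') (r₂ cx cy u p'))
          where
          r₁ : ∀ cx cy p u' → cx + cy + (p + u') ≡ cx + p + (cy + u')
          r₁ = solve-∀
          r₂ : ∀ cx cy u p' → cy + u + (cx + p') ≡ cx + cy + (p' + u)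
          r₂ = solve-∀

    -- The increments fix the counts up to a common constant, and that constant is fixed by the
    -- total, which is n at both positions.
    ∼⇒cnt : ∀ {i j} → quad n i ∼ quad n j → ∀ y → y < k → cnt y i n ≡ cnt y j n
    ∼⇒cnt {i} {j} s = increments-sum-unique k inc (trans (sumTo-cnt i n) (sym (sumTo-cnt j n)))
      where
      inc : ∀ x → suc x < k → cnt (suc x) i n + cnt x j n ≡ cnt (suc x) j n + cnt x i n
      inc x x+1<k = lem (cnt (suc x) i n) (cnt (suc x) j n) (cnt x i n) (cnt x j n) _ _ _ _
        (cnt-increment n i (<⇒≤ x+1<k) x+1<k ≈-refl) (cnt-increment n j (<⇒≤ x+1<k) x+1<k ≈-refl) (at s (suc x) x+1<k)
        where
        lem : ∀ c c' d d' u p u' p' → c + u ≡ d + p → c' + u' ≡ d' + p' → p + u' ≡ p' + u → c + d' ≡ c' + d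
        lem c c' d d' u p u' p' h h' g = +-cancelʳ-≡ (p' + u) _ _
          (trans (r₁ c d' p' u) (trans (cong₂ _+_ h (sym h')) (trans (r₂ d p c' u') (cong (c' + d +_) g))))
          where
          r₁ : ∀ c d' p' u → c + d' + (p' + u) ≡ c + u + (d' + p')
          r₁ = solve-∀
          r₂ : ∀ d p c' u' → d + p + (c' + u') ≡ c' + d + (p + u')
          r₂ = solve-∀

    parikh≡⇒∼ : ∀ {i j} → parikh k (factor k i n) ≡ parikh k (factor k j n) → quad n i ∼ quad n j
    parikh≡⇒∼ {i} {j} eq = cnt⇒∼ (λ y y<k → trans (sym (entry i y<k)) (trans (cong (λ v → lookup v (fromℕ< y<k)) eq) (entry j y<k)))
      where
      entry : ∀ i {y} (y<k : y < k) → lookup (parikh k (factor k i n)) (fromℕ< y<k) ≡ cnt y i n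
      entry i {y} y<k = trans (lookup∘tabulate _ (fromℕ< y<k))
        (trans (cong (λ z → occ z (factor k i n)) (toℕ-fromℕ< y<k)) (occ-factor y i n))

    ∼⇒parikh≡ : ∀ {i j} → quad n i ∼ quad n j → parikh k (factor k i n) ≡ parikh k (factor k j n)
    ∼⇒parikh≡ {i} {j} s = tabulate-cong (λ a → trans (occ-factor (toℕ a) i n)
      (trans (∼⇒cnt s (toℕ a) (toℕ<n a)) (sym (occ-factor (toℕ a) j n))))

-- Lengths of duplicate-free lists.

module _ {A : Set} where

  unique-length : {xs ys : List A} → Unique xs → Unique ys →
    (∀ {x} → x ∈ xs → x ∈ ys) → (∀ {x} → x ∈ ys → x ∈ xs) → length xs ≡ length ys
  unique-length u v f g = ↭-length (∼bag⇒↭ (unique∧set⇒bag u v (mk⇔ f g)))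

  length-filter-¬ : {P : A → Set} (P? : Decidable P) (xs : List A) →
    length (filter (λ x → ¬? (P? x)) xs) + length (filter P? xs) ≡ length xs
  length-filter-¬ P? [] = refl
  length-filter-¬ P? (x ∷ xs) with P? x
  ... | yes _ = trans (+-suc _ _) (cong suc (length-filter-¬ P? xs))
  ... | no  _ = cong suc (length-filter-¬ P? xs)

module _ {A B : Set} where

  unique-map : {f : A → B} {xs : List A} → Unique xs →
    (∀ {x y} → x ∈ xs → y ∈ xs → f x ≡ f y → x ≡ y) → Unique (map f xs)
  unique-map [] inj = []
  unique-map {f} {x ∷ xs} (x∉ ∷ u) inj =
    All.tabulate (λ z∈ fx≡z → case z∈ fx≡z) ∷ unique-map u (λ p q → inj (there p) (there q))
    where
    case : ∀ {z} → z ∈ map f xs → f x ≢ z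
    case z∈ fx≡z with y , y∈ , refl ← ∈-map⁻ f z∈ = All.lookup x∉ y∈ (inj (here refl) (there y∈) fx≡z)

  unique-concatMap : {f : A → List B} {xs : List A} → Unique xs → (∀ x → x ∈ xs → Unique (f x)) →
    (∀ {x y z} → x ∈ xs → y ∈ xs → z ∈ f x → z ∈ f y → x ≡ y) → Unique (concatMap f xs)
  unique-concatMap {xs = []} [] uf disj = []
  unique-concatMap {f} {x ∷ xs} (x∉ ∷ u) uf disj = Unique.++⁺ (uf x (here refl))
    (unique-concatMap u (λ y y∈ → uf y (there y∈)) (λ p q → disj (there p) (there q)))
    (λ (z∈fx , z∈) → let y , y∈ , z∈fy = find (∈-concatMap⁻ f z∈) in
      All.lookup x∉ y∈ (disj (here refl) (there y∈) z∈fx z∈fy))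

  length-cartesianProduct : (xs : List A) (ys : List B) → length (cartesianProduct xs ys) ≡ length xs * length ys
  length-cartesianProduct [] ys = refl
  length-cartesianProduct (x ∷ xs) ys = trans (length-++ (map (x ,_) ys))
    (cong₂ _+_ (length-map (x ,_) ys) (length-cartesianProduct xs ys))

module _ {B : Set} where

  length-concatMap-upTo : (f : ℕ → List B) → ∀ m → length (concatMap f (upTo m)) ≡ sumTo (λ c → length (f c)) m
  length-concatMap-upTo f zero = refl
  length-concatMap-upTo f (suc m) = begin
    length (concatMap f (upTo (suc m)))             ≡⟨ cong (length ∘ concatMap f) (upTo-∷ʳ m) ⟨
    length (concatMap f (upTo m ++ [ m ]))          ≡⟨ cong length (concatMap-++ f (upTo m) [ m ]) ⟩
    length (concatMap f (upTo m) ++ (f m ++ []))    ≡⟨ length-++ (concatMap f (upTo m)) ⟩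
    length (concatMap f (upTo m)) + length (f m ++ [])
      ≡⟨ cong₂ _+_ (length-concatMap-upTo f m) (cong length (++-identityʳ (f m))) ⟩
    sumTo (λ c → length (f c)) m + length (f m)     ∎
    where
    open ≡-Reasoning

m+m≤n⇒m≤⌊n/2⌋ : ∀ {m n} → m + m ≤ n → m ≤ ⌊ n /2⌋
m+m≤n⇒m≤⌊n/2⌋ {m} p = ≤-trans (≤-reflexive (n≡⌊n+n/2⌋ m)) (⌊n/2⌋-mono p)

m≤⌊n/2⌋⇒m+m≤n : ∀ {m} n → m ≤ ⌊ n /2⌋ → m + m ≤ n
m≤⌊n/2⌋⇒m+m≤n n p = ≤-trans (+-mono-≤ p (≤-trans p (⌊n/2⌋≤⌈n/2⌉ n))) (≤-reflexive (⌊n/2⌋+⌈n/2⌉≡n n))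

⌊n/2⌋+⌊n/2⌋+n%2≡n : ∀ n → ⌊ n /2⌋ + ⌊ n /2⌋ + n % 2 ≡ n
⌊n/2⌋+⌊n/2⌋+n%2≡n zero = refl
⌊n/2⌋+⌊n/2⌋+n%2≡n (suc zero) = refl
⌊n/2⌋+⌊n/2⌋+n%2≡n (suc (suc n)) = trans (cong (_+ n % 2) (+-suc (suc ⌊ n /2⌋) ⌊ n /2⌋))
  (cong (suc ∘ suc) (⌊n/2⌋+⌊n/2⌋+n%2≡n n))

-- Two-element multisets as sorted pairs.

sort : ℕ → ℕ → Pair
sort x y = x ⊓ y , x ⊔ y

sort-≤ : ∀ {x y} → x ≤ y → sort x y ≡ (x , y)
sort-≤ p = cong₂ _,_ (m≤n⇒m⊓n≡m p) (m≤n⇒m⊔n≡n p)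

sort-comm : ∀ x y → sort x y ≡ sort y x
sort-comm x y = cong₂ _,_ (⊓-comm x y) (⊔-comm x y)

sort-≥ : ∀ {x y} → y ≤ x → sort x y ≡ (y , x)
sort-≥ {x} {y} p = trans (sort-comm x y) (sort-≤ p)

sort-cases : ∀ x y → sort x y ≡ (x , y) ⊎ sort x y ≡ (y , x)
sort-cases x y = Sum.map sort-≤ sort-≥ (≤-total x y)

sort-inj : ∀ {x y x' y'} → sort x y ≡ sort x' y' → (x ≡ x' × y ≡ y') ⊎ (x ≡ y' × y ≡ x')
sort-inj {x} {y} {x'} {y'} eq with sort-cases x y | sort-cases x' y'
... | inj₁ p | inj₁ q = inj₁ (,-injective (trans (sym p) (trans eq q)))
... | inj₁ p | inj₂ q = inj₂ (,-injective (trans (sym p) (trans eq q)))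
... | inj₂ p | inj₁ q = let a , b = ,-injective (trans (sym p) (trans eq q)) in inj₂ (b , a)
... | inj₂ p | inj₂ q = let a , b = ,-injective (trans (sym p) (trans eq q)) in inj₁ (b , a)

mult-sort : ∀ x y z → mult (sort x y) z ≡ mult (x , y) z
mult-sort x y z with sort-cases x y
... | inj₁ p = cong (λ P → mult P z) p
... | inj₂ p = trans (cong (λ P → mult P z) p) (+-comm (δ y z) (δ x z))

sort-sum : ∀ x y → proj₁ (sort x y) + proj₂ (sort x y) ≡ x + y
sort-sum x y with sort-cases x y
... | inj₁ p = cong (λ P → proj₁ P + proj₂ P) p
... | inj₂ p = trans (cong (λ P → proj₁ P + proj₂ P) p) (+-comm y x)

infix 4 _∈₂_
_∈₂_ : ℕ → Pair → Set
x ∈₂ (u , w) = x ≡ u ⊎ x ≡ w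

∈₂-sort⁺ : ∀ {z} x y → z ∈₂ (x , y) → z ∈₂ sort x y
∈₂-sort⁺ {z} x y h with sort-cases x y
... | inj₁ p = subst (z ∈₂_) (sym p) h
... | inj₂ p = subst (z ∈₂_) (sym p) (Sum.swap h)

∈₂-sort⁻ : ∀ {z} x y → z ∈₂ sort x y → z ∈₂ (x , y)
∈₂-sort⁻ {z} x y h with sort-cases x y
... | inj₁ p = subst (z ∈₂_) p h
... | inj₂ p = Sum.swap (subst (z ∈₂_) p h)

Shared : Quad → Set
Shared (P , U) = proj₁ P ∈₂ U ⊎ proj₂ P ∈₂ U

shared? : Decidable Shared
shared? ((p , q) , (u , w)) = (p ≟ u ⊎-dec p ≟ w) ⊎-dec (q ≟ u ⊎-dec q ≟ w)

shared⁺ : ∀ {z} P U → z ∈₂ P → z ∈₂ U → Shared (P , U)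
shared⁺ P U (inj₁ refl) h = inj₁ h
shared⁺ P U (inj₂ refl) h = inj₂ h

shared⁻ : ∀ P U → Shared (P , U) → ∃ λ z → z ∈₂ P × z ∈₂ U
shared⁻ P U (inj₁ h) = _ , inj₁ refl , h
shared⁻ P U (inj₂ h) = _ , inj₂ refl , h

mult-pos : ∀ {P} {y} → y ∈₂ P → 1 ≤ mult P y
mult-pos {p , q} {y} (inj₁ refl) = ≤-trans (≤-reflexive (sym (δ-≡ {p} refl))) (m≤m+n (δ p y) (δ q y))
mult-pos {p , q} {y} (inj₂ refl) = ≤-trans (≤-reflexive (sym (δ-≡ {q} refl))) (m≤n+m (δ q y) (δ p y))

δ-pos⁻ : ∀ {x y} → 1 ≤ δ x y → y ≡ x
δ-pos⁻ {x} {y} h with x ≟ y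
... | yes p = sym p
... | no ¬p = contradiction (subst (1 ≤_) (δ-≢ ¬p) h) λ ()

mult-pos⁻ : ∀ {P y} → 1 ≤ mult P y → y ∈₂ P
mult-pos⁻ {p , q} {y} h with p ≟ y
... | yes r = inj₁ (sym r)
... | no ¬r = inj₂ (δ-pos⁻ (subst (λ z → 1 ≤ z + δ q y) (δ-≢ ¬r) h))

mult-zero : ∀ {P y} → ¬ (y ∈₂ P) → mult P y ≡ 0
mult-zero h = cong₂ _+_ (δ-≢ (λ p → h (inj₁ (sym p)))) (δ-≢ (λ p → h (inj₂ (sym p))))

-- Each 2-element multiset of letters has exactly one such `Pair`, so that counting pairs counts
-- multisets.
Between : ℕ → Pair → Set
Between k (p , q) = p ≤ q × q < k

sort-Between : ∀ {k x y} → x < k → y < k → Between k (sort x y)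
sort-Between {x = x} {y} x<k y<k = m⊓n≤m⊔n x y , ⊔-lub x<k y<k

-- Containment between multisets of the same size is equality. In the crossed case q = p' ≤ q' = p ≤
-- q, so all four entries coincide.
mult-≤⇒≡ : ∀ {k P P'} → Between k P → Between k P' → (∀ y → y < k → mult P y ≤ mult P' y) → P ≡ P'
mult-≤⇒≡ {k} {p , q} {p' , q'} (p≤q , q<k) (p'≤q' , q'<k) h
  with mult-pos⁻ {p' , q'} (≤-trans (mult-pos {p , q} (inj₁ refl)) (h p (≤-<-trans p≤q q<k)))
... | inj₁ refl = cong (p ,_) (δ-pos⁻ (≤-trans (≤-reflexive (sym (δ-≡ {q} refl)))
        (+-cancelˡ-≤ (δ p q) _ _ (h q q<k))))
... | inj₂ refl = cong₂ _,_ (trans p≡q q≡p') (trans (sym p≡q) refl)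
  where
  q≡p' : q ≡ p'
  q≡p' = δ-pos⁻ (≤-trans (≤-reflexive (sym (δ-≡ {q} refl)))
    (+-cancelˡ-≤ (δ p q) _ _ (≤-trans (h q q<k) (≤-reflexive (+-comm (δ p' q) (δ p q))))))
  p≡q : p ≡ q
  p≡q = ≤-antisym p≤q (subst (_≤ p) (sym q≡p') p'≤q')

-- Sorted pairs of letters with a prescribed sum modulo k.

module PairSums (k : ℕ) .{{_ : NonZero k}} where
  open Modular k
  open Cancellation k

  -- The pairs p ≤ q with p + q = c, respectively with p + q = c + k.
  low high pairsSumming : ℕ → List Pair
  low c  = map (λ p → p , c ∸ p) (upTo (suc ⌊ c /2⌋))
  high c = map (λ j → suc c + j , pred k ∸ j) (upTo ⌊ k ∸ c /2⌋)
  pairsSumming c = low c ++ high c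

  pairsSumming-unique : ∀ c → Unique (pairsSumming c)
  pairsSumming-unique c = Unique.++⁺
    (Unique.map⁺ (λ eq → proj₁ (,-injective eq)) (Unique.upTo⁺ _))
    (Unique.map⁺ (λ eq → +-cancelˡ-≡ (suc c) _ _ (proj₁ (,-injective eq))) (Unique.upTo⁺ _))
    λ (l , r) → disj l r
    where
    disj : ∀ {z} → z ∈ low c →
           ¬ (z ∈ high c)
    disj l r with p , p∈ , refl ← ∈-map⁻ _ l | j , _ , eq ← ∈-map⁻ _ r =
      contradiction (≤-trans (≤-pred (∈-upTo⁻ p∈)) (⌊n/2⌋≤n c))
        (<⇒≱ (subst (c <_) (sym (proj₁ (,-injective eq))) (s≤s (m≤m+n c j))))

  pairsSumming⁻ : ∀ {c P} → c < k → P ∈ pairsSumming c → Between k P × proj₁ P + proj₂ P ≈ c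
  pairsSumming⁻ {c} c<k P∈ with ∈-++⁻ (low c) P∈
  ... | inj₁ l with p , p∈ , refl ← ∈-map⁻ _ l =
    (m+n≤o⇒m≤o∸n p p+p≤c , ≤-<-trans (m∸n≤m c p) c<k) ,
    ≈-reflexive (m+[n∸m]≡n (≤-trans (m≤m+n p p) p+p≤c))
    where
    p+p≤c : p + p ≤ c
    p+p≤c = m≤⌊n/2⌋⇒m+m≤n c (≤-pred (∈-upTo⁻ p∈))
  ... | inj₂ r with j , j∈ , refl ← ∈-map⁻ _ r =
    (m+n≤o⇒m≤o∸n (suc c + j) bound , ≤-trans (s≤s (m∸n≤m (pred k) j)) (≤-reflexive (suc-pred k))) ,
    ≈-trans (≈-reflexive (begin
      suc c + j + (pred k ∸ j)     ≡⟨ +-assoc (suc c) j _ ⟩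
      suc c + (j + (pred k ∸ j))   ≡⟨ cong (suc c +_) (m+[n∸m]≡n (≤-trans (m≤n+m j (suc c + j)) bound)) ⟩
      suc (c + pred k)             ≡⟨ +-suc c (pred k) ⟨
      c + suc (pred k)             ≡⟨ cong (c +_) (suc-pred k) ⟩
      c + k                        ∎)) (+-k-≈ c)
    where
    open ≡-Reasoning
    lem : ∀ c j → c + ((1 + j) + (1 + j)) ≡ 1 + (1 + c + j + j)
    lem = solve-∀
    bound : suc c + j + j ≤ pred k
    bound = ≤-pred (≤-trans (≤-trans (≤-reflexive (sym (lem c j)))
      (≤-trans (+-monoʳ-≤ c (m≤⌊n/2⌋⇒m+m≤n (k ∸ c) (∈-upTo⁻ j∈))) (≤-reflexive (m+[n∸m]≡n (<⇒≤ c<k)))))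
      (≤-reflexive (sym (suc-pred k))))

  -- As p + q < 2k, the sum is c or c + k. In the second case q < k forces p > c, so p is
  -- `suc c + j`, and p ≤ q turns into 2 (j + 1) ≤ k - c, the range of `high`.
  pairsSumming⁺ : ∀ {c P} → c < k → Between k P → proj₁ P + proj₂ P ≈ c → P ∈ pairsSumming c
  pairsSumming⁺ {c} {p , q} c<k (p≤q , q<k) s with p + q <? k
  ... | yes p+q<k with refl ← ≈⇒≡ p+q<k c<k s = ∈-++⁺ˡ (subst (_∈ low (p + q)) (cong (p ,_) (m+n∸m≡n p q))
        (∈-map⁺ (λ p' → p' , (p + q) ∸ p') (∈-upTo⁺ (s≤s (m+m≤n⇒m≤⌊n/2⌋ (+-monoʳ-≤ p p≤q))))))
  ... | no p+q≮k = ∈-++⁺ʳ (low c) (subst (_∈ high c) (cong₂ _,_ p≡ (sym q≡))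
        (∈-map⁺ (λ j → suc c + j , pred k ∸ j) (∈-upTo⁺ (m+m≤n⇒m≤⌊n/2⌋ (m+n≤o⇒m≤o∸n (suc j + suc j) bound)))))
    where
    d = p + q ∸ k
    d+k : d + k ≡ p + q
    d+k = m∸n+n≡m (≮⇒≥ p+q≮k)
    d<p : d < p
    d<p = +-cancelʳ-< k d p (subst (_< p + k) (sym d+k) (+-monoʳ-< p q<k))
    d≡c : d ≡ c
    d≡c = ≈⇒≡ (<-trans d<p (≤-<-trans p≤q q<k)) c<k (≈-trans (≈-sym (+-k-≈ d)) (≈-trans (≈-reflexive d+k) s))
    c<p : c < p
    c<p = subst (_< p) d≡c d<p
    j = p ∸ suc c
    p≡ : suc c + j ≡ p
    p≡ = m+[n∸m]≡n c<p
    j+q : suc (j + q) ≡ k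
    j+q = +-cancelˡ-≡ c _ _ (trans (trans (lem c j q) (cong (_+ q) p≡)) (trans (sym d+k) (cong (_+ k) d≡c)))
      where
      lem : ∀ c j q → c + (1 + (j + q)) ≡ 1 + c + j + q
      lem = solve-∀
    q≡ : q ≡ pred k ∸ j
    q≡ = trans (sym (m+n∸m≡n j q)) (cong (_∸ j) (cong pred j+q))
    bound : suc j + suc j + c ≤ k
    bound = ≤-trans (≤-reflexive (lem j c)) (≤-trans (s≤s (+-monoʳ-≤ j (≤-trans (≤-reflexive p≡) p≤q))) (≤-reflexive j+q))
      where
      lem : ∀ j c → 1 + j + (1 + j) + c ≡ 1 + (j + (1 + c + j))
      lem = solve-∀

  -- The lists `low c` and `high c` have 1 + ⌊c/2⌋ and ⌊(k - c)/2⌋ entries; doubling and restoring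
  -- the two parity bits removes the floors.
  length-pairsSumming : ∀ {c} → c < k → 2 * length (pairsSumming c) + (c % 2 + (k ∸ c) % 2) ≡ 2 + k
  length-pairsSumming {c} c<k = begin
    2 * length (pairsSumming c) + (c % 2 + (k ∸ c) % 2)
      ≡⟨ cong (λ l → 2 * l + (c % 2 + (k ∸ c) % 2)) (trans (length-++ (low c))
           (cong₂ _+_ (trans (length-map _ (upTo (suc ⌊ c /2⌋))) (length-upTo (suc ⌊ c /2⌋)))
                      (trans (length-map _ (upTo ⌊ k ∸ c /2⌋)) (length-upTo ⌊ k ∸ c /2⌋)))) ⟩
    2 * (suc ⌊ c /2⌋ + ⌊ k ∸ c /2⌋) + (c % 2 + (k ∸ c) % 2)
      ≡⟨ lem ⌊ c /2⌋ ⌊ k ∸ c /2⌋ (c % 2) ((k ∸ c) % 2) ⟩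
    2 + ((⌊ c /2⌋ + ⌊ c /2⌋ + c % 2) + (⌊ k ∸ c /2⌋ + ⌊ k ∸ c /2⌋ + (k ∸ c) % 2))
      ≡⟨ cong (2 +_) (cong₂ _+_ (⌊n/2⌋+⌊n/2⌋+n%2≡n c) (⌊n/2⌋+⌊n/2⌋+n%2≡n (k ∸ c))) ⟩
    2 + (c + (k ∸ c))
      ≡⟨ cong (2 +_) (m+[n∸m]≡n (<⇒≤ c<k)) ⟩
    2 + k ∎
    where
    open ≡-Reasoning
    lem : ∀ x y a b → 2 * (1 + x + y) + (a + b) ≡ 2 + ((x + x + a) + (y + y + b))
    lem = solve-∀

-- Representatives of the balanced differences.

module Canonical (k : ℕ) .{{_ : NonZero k}} (n : ℕ) where
  open Modular k
  open Cancellation k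
  open PairSums k

  Balanced : Quad → Set
  Balanced ((p , q) , (u , w)) = p + q + n ≈ u + w

  block : ℕ → List Quad
  block c = cartesianProduct (pairsSumming c) (pairsSumming ((c + n) % k))

  quads : List Quad
  quads = concatMap block (upTo k)

  block⁻ : ∀ {c P U} → c < k → (P , U) ∈ block c →
    (Between k P × proj₁ P + proj₂ P ≈ c) × (Between k U × proj₁ U + proj₂ U ≈ c + n)
  block⁻ {c} c<k a∈ with P∈ , U∈ ← ∈-cartesianProduct⁻ (pairsSumming c) (pairsSumming ((c + n) % k)) a∈
    with U-between , U-sum ← pairsSumming⁻ (m%n<n (c + n) k) U∈ =
    pairsSumming⁻ c<k P∈ , (U-between , ≈-trans U-sum (%-≈ (c + n)))

  quads-unique : Unique quads
  quads-unique = unique-concatMap (Unique.upTo⁺ k)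
    (λ c _ → Unique.cartesianProduct⁺ (pairsSumming-unique c) (pairsSumming-unique ((c + n) % k)))
    (λ c∈ d∈ z∈ z∈' → ≈⇒≡ (∈-upTo⁻ c∈) (∈-upTo⁻ d∈)
      (≈-trans (≈-sym (proj₂ (proj₁ (block⁻ (∈-upTo⁻ c∈) z∈)))) (proj₂ (proj₁ (block⁻ (∈-upTo⁻ d∈) z∈')))))

  quads⁻ : ∀ {P U} → (P , U) ∈ quads → Between k P × Between k U × Balanced (P , U)
  quads⁻ a∈ with c , c∈ , a∈' ← find (∈-concatMap⁻ block a∈)
    with (bP , sP) , (bU , sU) ← block⁻ (∈-upTo⁻ c∈) a∈' =
    bP , bU , ≈-trans (+-cong-≈ sP (≈-refl {n})) (≈-sym sU)

  quads⁺ : ∀ {P U} → Between k P → Between k U → Balanced (P , U) → (P , U) ∈ quads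
  quads⁺ {P@(p , q)} {U@(u , w)} bP bU bal = ∈-concatMap⁺ block (lose (∈-upTo⁺ c<k)
    (∈-cartesianProduct⁺ (pairsSumming⁺ c<k bP (≈-sym (%-≈ (p + q))))
      (pairsSumming⁺ (m%n<n (c + n) k) bU (≈-trans (≈-sym bal)
        (≈-trans (+-cong-≈ (≈-sym (%-≈ (p + q))) (≈-refl {n})) (≈-sym (%-≈ (c + n))))))))
    where
    c = (p + q) % k
    c<k = m%n<n (p + q) k

  disjointQuads : List Quad
  disjointQuads = filter (λ a → ¬? (shared? a)) quads

  -- Uniqueness of the reduced form. Where P has a letter, U has none, so the equation shows that P
  -- is contained in P'. Equal sizes give P = P', and then P cancels.
  disjoint-∼⇒≡ : ∀ {P U P' U'} → Between k P → Between k U → Between k P' → Between k U' →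
    ¬ Shared (P , U) → (P , U) ∼ (P' , U') → (P , U) ≡ (P' , U')
  disjoint-∼⇒≡ {P} {U} {P'} {U'} bP bU bP' bU' ¬sh s = cong₂ _,_ P≡P' (mult-≤⇒≡ bU bU' U≤)
    where
    P≤ : ∀ y → y < k → mult P y ≤ mult P' y
    P≤ y y<k with mult P y in eq
    ... | zero  = z≤n
    ... | suc m = ≤-trans (m≤m+n (suc m) (mult U' y)) (≤-reflexive (begin
      suc m + mult U' y  ≡⟨ cong (_+ mult U' y) eq ⟨
      mult P y + mult U' y  ≡⟨ at s y y<k ⟩
      mult P' y + mult U y  ≡⟨ cong (mult P' y +_) (mult-zero {U} (λ y∈U → ¬sh (shared⁺ P U y∈P y∈U))) ⟩
      mult P' y + 0      ≡⟨ +-identityʳ _ ⟩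
      mult P' y          ∎))
      where
      open ≡-Reasoning
      y∈P : y ∈₂ P
      y∈P = mult-pos⁻ {P} (subst (1 ≤_) (sym eq) (s≤s z≤n))
    P≡P' : P ≡ P'
    P≡P' = mult-≤⇒≡ bP bP' P≤
    U≤ : ∀ y → y < k → mult U y ≤ mult U' y
    U≤ y y<k = ≤-reflexive (sym (+-cancelˡ-≡ (mult P y) _ _ (trans (at s y y<k) (cong (λ Q → mult Q y + mult U y) (sym P≡P')))))

  -- The difference q - w of two letters, padded by 0 on both sides to fit into a `Quad`. The
  -- padding keeps both pairs sorted and makes the quad `Shared`, hence different from every member
  -- of `disjointQuads`.
  degenerate : ℕ → ℕ → Quad
  degenerate q w = (0 , q) , (0 , w)

  shared-∼ : ∀ x q w → ((x , q) , (x , w)) ∼ degenerate q w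
  shared-∼ x q w = mk∼ λ y _ → lem (δ x y) (δ q y) (δ 0 y) (δ w y)
    where
    lem : ∀ a b c d → a + b + (c + d) ≡ c + b + (a + d)
    lem = solve-∀

  swapˡ-∼ : ∀ {p q U a} → ((p , q) , U) ∼ a → ((q , p) , U) ∼ a
  swapˡ-∼ {p} {q} {a = a} s = mk∼ λ y y<k → trans (cong (_+ mult (proj₂ a) y) (+-comm (δ q y) (δ p y))) (at s y y<k)

  swapʳ-∼ : ∀ {P u w a} → (P , (u , w)) ∼ a → (P , (w , u)) ∼ a
  swapʳ-∼ {u = u} {w} {a} s = mk∼ λ y y<k → trans (at s y y<k) (cong (mult (proj₁ a) y +_) (+-comm (δ u y) (δ w y)))

  cancel-shared : ∀ x {q w} → x + q + n ≈ x + w → q + n ≈ w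
  cancel-shared x {q} h = +-cancelˡ-≈ x (≈-trans (≈-reflexive (sym (+-assoc x q n))) h)

  -- Quads with a common letter in the two pairs reduce to a difference of two letters;
  -- D lists representatives of these.
  record Degenerates (D : List Quad) : Set where
    field
      unique   : Unique D
      sound    : ∀ {a} → a ∈ D → ∃ λ q → ∃ λ w → a ≡ degenerate q w × q < k × w < k × q + n ≈ w
      ∼⇒≡      : ∀ {a b} → a ∈ D → b ∈ D → a ∼ b → a ≡ b
      complete : ∀ {q w} → q < k → w < k → q + n ≈ w → ∃ λ a → a ∈ D × degenerate q w ∼ a

  -- One representative for each class of `∼` among the balanced quads of letters; its length is the
  -- abelian complexity once every class is known to occur.
  record Transversal (C : List Quad) : Set where
    field
      unique   : Unique C
      sound    : ∀ {p q u w} → ((p , q) , (u , w)) ∈ C → (p < k × q < k × u < k × w < k) × Balanced ((p , q) , (u , w))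
      ∼⇒≡      : ∀ {a b} → a ∈ C → b ∈ C → a ∼ b → a ≡ b
      complete : ∀ p q u w → p < k → q < k → u < k → w < k → Balanced ((p , q) , (u , w)) →
                 ∃ λ a → a ∈ C × ((p , q) , (u , w)) ∼ a

  module _ {D} (deg : Degenerates D) where
    private module D = Degenerates deg

    C : List Quad
    C = disjointQuads ++ D

    D-between : ∀ {P U} → (P , U) ∈ D → (Between k P × Between k U × Balanced (P , U)) × Shared (P , U)
    D-between a∈ with q , w , refl , q<k , w<k , bal ← D.sound a∈ =
      ((z≤n , q<k) , (z≤n , w<k) , bal) , inj₁ (inj₁ refl)

    C-between : ∀ {P U} → (P , U) ∈ C → Between k P × Between k U × Balanced (P , U)
    C-between a∈ with ∈-++⁻ disjointQuads a∈
    ... | inj₁ l = quads⁻ (proj₁ (∈-filter⁻ (λ a → ¬? (shared? a)) {xs = quads} l))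
    ... | inj₂ r = proj₁ (D-between r)

    transversal : Transversal C
    transversal = record
      { unique = Unique.++⁺ (Unique.filter⁺ (λ a → ¬? (shared? a)) quads-unique) D.unique
          λ (l , r) → proj₂ (∈-filter⁻ (λ a → ¬? (shared? a)) {xs = quads} l) (proj₂ (D-between r))
      ; sound = λ a∈ → let (p≤q , q<k) , (u≤w , w<k) , bal = C-between a∈ in
          (≤-<-trans p≤q q<k , q<k , ≤-<-trans u≤w w<k , w<k) , bal
      ; ∼⇒≡ = eq
      ; complete = comp
      }
      where
      eq : ∀ {a b} → a ∈ C → b ∈ C → a ∼ b → a ≡ b
      eq a∈ b∈ s with ∈-++⁻ disjointQuads a∈ | ∈-++⁻ disjointQuads b∈
      -- One disjoint member suffices: `disjoint-∼⇒≡` asks the other one just for sorted pairs of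
      -- letters, so a member of D may stand there.
      ... | inj₁ l | _ with bP , bU , _ ← C-between a∈ | bP' , bU' , _ ← C-between b∈ =
        disjoint-∼⇒≡ bP bU bP' bU' (proj₂ (∈-filter⁻ (λ a → ¬? (shared? a)) {xs = quads} l)) s
      ... | inj₂ _ | inj₁ l with bP , bU , _ ← C-between a∈ | bP' , bU' , _ ← C-between b∈ =
        sym (disjoint-∼⇒≡ bP' bU' bP bU (proj₂ (∈-filter⁻ (λ a → ¬? (shared? a)) {xs = quads} l)) (∼-sym s))
      ... | inj₂ r | inj₂ r' = D.∼⇒≡ r r' s

      -- `x` is the shared letter, and `f` undoes the swaps that brought it to the front of both
      -- pairs.
      fromD : ∀ {a} x {q w} → q < k → w < k → x + q + n ≈ x + w →
        (∀ {b} → ((x , q) , (x , w)) ∼ b → a ∼ b) → ∃ λ b → b ∈ C × a ∼ b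
      fromD x {q} {w} q<k w<k bal f with b , b∈ , s ← D.complete q<k w<k (cancel-shared x bal) =
        b , ∈-++⁺ʳ disjointQuads b∈ , f (∼-trans (shared-∼ x q w) s)

      comp : ∀ p q u w → p < k → q < k → u < k → w < k → Balanced ((p , q) , (u , w)) →
             ∃ λ a → a ∈ C × ((p , q) , (u , w)) ∼ a
      comp p q u w p< q< u< w< bal with shared? ((p , q) , (u , w))
      ... | yes (inj₁ (inj₁ refl)) = fromD p q< w< bal (λ s → s)
      ... | yes (inj₁ (inj₂ refl)) = fromD p q< u< (≈-trans bal (≈-reflexive (+-comm u p)))
              swapʳ-∼
      ... | yes (inj₂ (inj₁ refl)) = fromD q p< w< (≈-trans (≈-reflexive (cong (_+ n) (+-comm q p))) bal)
              swapˡ-∼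
      ... | yes (inj₂ (inj₂ refl)) = fromD q p< u< (≈-trans (≈-reflexive (cong (_+ n) (+-comm q p)))
              (≈-trans bal (≈-reflexive (+-comm u q))))
              (swapʳ-∼ ∘ swapˡ-∼)
      ... | no ¬sh = (sort p q , sort u w) ,
        ∈-++⁺ˡ (∈-filter⁺ (λ a → ¬? (shared? a)) (quads⁺ (sort-Between p< q<) (sort-Between u< w<) bal')
          λ sh → let z , z∈P , z∈U = shared⁻ (sort p q) (sort u w) sh in
            ¬sh (shared⁺ (p , q) (u , w) (∈₂-sort⁻ p q z∈P) (∈₂-sort⁻ u w z∈U))) ,
        mk∼ λ y _ → cong₂ _+_ (sym (mult-sort p q y)) (mult-sort u w y)
        where
        bal' : Balanced (sort p q , sort u w)
        bal' = ≈-trans (≈-reflexive (cong (_+ n) (sort-sum p q))) (≈-trans bal (≈-reflexive (sym (sort-sum u w))))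

  sharedQuads : List Quad
  sharedQuads = filter shared? quads

  module Divisible (n≈0 : n ≈ 0) where

    D : List Quad
    D = [ degenerate 0 0 ]

    q≈w : ∀ {q w} → q < k → w < k → q + n ≈ w → q ≡ w
    q≈w {q} q< w< h = ≈⇒≡ q< w< (≈-trans (≈-sym (≈-trans (+-cong-≈ (≈-refl {q}) n≈0) (≈-reflexive (+-identityʳ q)))) h)

    degenerates : 0 < k → Degenerates D
    degenerates 0<k = record
      { unique = [] ∷ []
      ; sound = λ { (here refl) → 0 , 0 , refl , 0<k , 0<k , n≈0 }
      ; ∼⇒≡ = λ { (here refl) (here refl) _ → refl }
      ; complete = λ {q} q< w< h → degenerate 0 0 , here refl , comp (q≈w q< w< h)
      }
      where
      lem : ∀ a b → a + b + (a + a) ≡ a + a + (a + b)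
      lem = solve-∀
      comp : ∀ {q w} → q ≡ w → degenerate q w ∼ degenerate 0 0
      comp {q} refl = mk∼ λ y _ → lem (δ 0 y) (δ q y)

    -- Cancelling a shared letter leaves q + n ≡ w, that is q = w, when k ∣ n. Hence the quads that
    -- share a letter form the diagonal P = U.
    sharedQuads-length : length sharedQuads ≡ length (concatMap pairsSumming (upTo k))
    sharedQuads-length = trans (unique-length (Unique.filter⁺ shared? quads-unique)
        (Unique.map⁺ (λ eq → proj₁ (,-injective eq)) (unique-concatMap (Unique.upTo⁺ k) (λ c _ → pairsSumming-unique c)
          (λ c∈ d∈ z∈ z∈' → ≈⇒≡ (∈-upTo⁻ c∈) (∈-upTo⁻ d∈)
            (≈-trans (≈-sym (proj₂ (pairsSumming⁻ (∈-upTo⁻ c∈) z∈))) (proj₂ (pairsSumming⁻ (∈-upTo⁻ d∈) z∈'))))))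
        to from) (length-map (λ P → P , P) (concatMap pairsSumming (upTo k)))
      where
      diag : ∀ {P U} → Between k P → Between k U → Balanced (P , U) → Shared (P , U) → P ≡ U
      diag {p , q} {u , w} (p≤q , q<k) (u≤w , w<k) bal (inj₁ (inj₁ refl)) =
        cong (p ,_) (q≈w q<k w<k (cancel-shared p bal))
      -- A crossed match p = w, q = u forces all four letters to coincide, both pairs being sorted.
      diag {p , q} {u , w} (p≤q , q<k) (u≤w , w<k) bal (inj₁ (inj₂ refl))
        with refl ← q≈w q<k (≤-<-trans u≤w w<k) (cancel-shared p (≈-trans bal (≈-reflexive (+-comm u p))))
        with refl ← ≤-antisym p≤q u≤w = refl
      diag {p , q} {u , w} (p≤q , q<k) (u≤w , w<k) bal (inj₂ (inj₁ refl))
        with refl ← q≈w (≤-<-trans p≤q q<k) w<k (cancel-shared q (≈-trans (≈-reflexive (cong (_+ n) (+-comm q p))) bal))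
        with refl ← ≤-antisym p≤q u≤w = refl
      diag {p , q} {u , w} (p≤q , q<k) (u≤w , w<k) bal (inj₂ (inj₂ refl)) =
        cong (_, q) (q≈w (≤-<-trans p≤q q<k) (≤-<-trans u≤w w<k) (cancel-shared q
          (≈-trans (≈-reflexive (cong (_+ n) (+-comm q p))) (≈-trans bal (≈-reflexive (+-comm u q))))))
      to : ∀ {a} → a ∈ sharedQuads → a ∈ map (λ P → P , P) (concatMap pairsSumming (upTo k))
      to {P@(p , q) , U} a∈ with a∈' , sh ← ∈-filter⁻ shared? {xs = quads} a∈
        with bP , bU , bal ← quads⁻ a∈'
        with refl ← diag bP bU bal sh =
        ∈-map⁺ (λ P → P , P) (∈-concatMap⁺ pairsSumming (lose (∈-upTo⁺ (m%n<n (p + q) k))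
          (pairsSumming⁺ (m%n<n (p + q) k) bP (≈-sym (%-≈ (p + q))))))
      from : ∀ {a} → a ∈ map (λ P → P , P) (concatMap pairsSumming (upTo k)) → a ∈ sharedQuads
      from a∈ with P@(p , q) , P∈ , refl ← ∈-map⁻ _ a∈
        with c , c∈ , P∈' ← find (∈-concatMap⁻ pairsSumming P∈)
        with bP , _ ← pairsSumming⁻ (∈-upTo⁻ c∈) P∈' =
        ∈-filter⁺ shared? (quads⁺ bP bP (≈-trans (+-cong-≈ (≈-refl {p + q}) n≈0) (≈-reflexive (+-identityʳ (p + q)))))
          (inj₁ (inj₁ refl))

  module Indivisible (n≉0 : ¬ (n ≈ 0)) where

    D : List Quad
    D = map (λ q → degenerate q ((q + n) % k)) (upTo k)

    shift-≢ : ∀ {q w} → q + n ≈ w → q ≢ w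
    shift-≢ {q} h refl = n≉0 (+-cancelˡ-≈ q (≈-trans h (≈-reflexive (sym (+-identityʳ q)))))

    degenerates : Degenerates D
    degenerates = record
      { unique = Unique.map⁺ (λ eq → proj₂ (,-injective (proj₁ (,-injective eq)))) (Unique.upTo⁺ k)
      ; sound = snd
      ; ∼⇒≡ = eq
      ; complete = λ {q} {w} q< w< h → degenerate q w ,
          subst (λ w' → degenerate q w' ∈ D) (sym (≈⇒≡% w< (≈-sym h))) (∈-map⁺ (λ q → degenerate q ((q + n) % k)) (∈-upTo⁺ q<)) ,
          mk∼ λ y _ → refl
      }
      where
      snd : ∀ {a} → a ∈ D → ∃ λ q → ∃ λ w → a ≡ degenerate q w × q < k × w < k × q + n ≈ w
      snd a∈ with q , q∈ , refl ← ∈-map⁻ _ a∈ = q , (q + n) % k , refl , ∈-upTo⁻ q∈ , m%n<n (q + n) k , ≈-sym (%-≈ (q + n))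
      eq : ∀ {a b} → a ∈ D → b ∈ D → a ∼ b → a ≡ b
      eq a∈ b∈ s with q , q∈ , refl ← ∈-map⁻ _ a∈ | q' , q'∈ , refl ← ∈-map⁻ _ b∈ =
        -- The letter q decides: as w ≠ q, it has multiplicity 1 in q - w, and in q' - w' this is
        -- possible only for q' = q.
        cong (λ q → degenerate q ((q + n) % k)) (δ-pos⁻ {q'} {q} (≤-trans (m≤m+n 1 (δ w' q)) (≤-reflexive q-count)))
        where
        w = (q + n) % k
        w' = (q' + n) % k
        lem : ∀ a b c → a + b + (a + c) ≡ a + a + (b + c)
        lem = solve-∀
        q-count : 1 + δ w' q ≡ δ q' q
        q-count = begin
          1 + δ w' q       ≡⟨ cong (_+ δ w' q) (δ-≡ {q} refl) ⟨
          δ q q + δ w' q   ≡⟨ +-cancelˡ-≡ (δ 0 q + δ 0 q) _ _ (trans (sym (lem (δ 0 q) (δ q q) (δ w' q)))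
                                (trans (at s q (∈-upTo⁻ q∈)) (lem (δ 0 q) (δ q' q) (δ w q)))) ⟩
          δ q' q + δ w q   ≡⟨ cong (δ q' q +_) (δ-≢ (≢-sym (shift-≢ (≈-sym (%-≈ (q + n)))))) ⟩
          δ q' q + 0       ≡⟨ +-identityʳ _ ⟩
          δ q' q           ∎
          where
          open ≡-Reasoning

    -- x is the common letter and q the other letter of the first pair; the balance then leaves q +
    -- n as the other letter of the second.
    sharing : ℕ × ℕ → Quad
    sharing (x , q) = sort x q , sort x ((q + n) % k)

    sharedQuads-length : length sharedQuads ≡ k * k
    sharedQuads-length = trans (unique-length (Unique.filter⁺ shared? quads-unique)
        (unique-map (Unique.cartesianProduct⁺ (Unique.upTo⁺ k) (Unique.upTo⁺ k)) (λ _ _ → inj)) to from)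
      (trans (length-map sharing (cartesianProduct (upTo k) (upTo k)))
        (trans (length-cartesianProduct (upTo k) (upTo k)) (cong₂ _*_ (length-upTo k) (length-upTo k))))
      where
      inj : ∀ {a b} → sharing a ≡ sharing b → a ≡ b
      inj {x , q} {x' , q'} eq with sort-inj {x} {q} {x'} {q'} (proj₁ (,-injective eq))
      ... | inj₁ (refl , refl) = refl
      -- The parameters (x , q) and (q , x) give the same first pair. Equal second pairs {x , q + n}
      -- and {q , x + n} mean x = q, or x = x + n modulo k, which k ∤ n excludes.
      ... | inj₂ (refl , refl) with sort-inj {x} {(q + n) % k} {q} {(x + n) % k} (proj₂ (,-injective eq))
      ...   | inj₁ (refl , _) = refl
      ...   | inj₂ (h , _) = contradiction h (shift-≢ (≈-sym (%-≈ (x + n))) )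
      mem : ∀ {x q} → x < k → q < k → sharing (x , q) ∈ map sharing (cartesianProduct (upTo k) (upTo k))
      mem x< q< = ∈-map⁺ sharing (∈-cartesianProduct⁺ (∈-upTo⁺ x<) (∈-upTo⁺ q<))
      mem' : ∀ x q {P U} w → x < k → q < k → w < k → x + q + n ≈ x + w → P ≡ sort x q → U ≡ sort x w →
        (P , U) ∈ map sharing (cartesianProduct (upTo k) (upTo k))
      mem' x q w x< q< w< bal refl refl =
        subst (λ w → (sort x q , sort x w) ∈ _) (sym (≈⇒≡% w< (≈-sym (cancel-shared x bal)))) (mem x< q<)
      to : ∀ {a} → a ∈ sharedQuads → a ∈ map sharing (cartesianProduct (upTo k) (upTo k))
      to {(p , q) , (u , w)} a∈ with a∈' , sh ← ∈-filter⁻ shared? {xs = quads} a∈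
        with (p≤q , q<k) , (u≤w , w<k) , bal ← quads⁻ a∈' = go sh
        where
        p<k = ≤-<-trans p≤q q<k
        u<k = ≤-<-trans u≤w w<k
        bal' : q + p + n ≈ u + w
        bal' = ≈-trans (≈-reflexive (cong (_+ n) (+-comm q p))) bal
        go : Shared ((p , q) , (u , w)) → ((p , q) , (u , w)) ∈ map sharing (cartesianProduct (upTo k) (upTo k))
        go (inj₁ (inj₁ refl)) = mem' p q w p<k q<k w<k bal (sym (sort-≤ p≤q)) (sym (sort-≤ u≤w))
        go (inj₁ (inj₂ refl)) = mem' p q u p<k q<k u<k (≈-trans bal (≈-reflexive (+-comm u p)))
          (sym (sort-≤ p≤q)) (sym (sort-≥ u≤w))
        go (inj₂ (inj₁ refl)) = mem' q p w q<k p<k w<k bal' (sym (sort-≥ p≤q)) (sym (sort-≤ u≤w))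
        go (inj₂ (inj₂ refl)) = mem' q p u q<k p<k u<k (≈-trans bal' (≈-reflexive (+-comm u q)))
          (sym (sort-≥ p≤q)) (sym (sort-≥ u≤w))
      from : ∀ {a} → a ∈ map sharing (cartesianProduct (upTo k) (upTo k)) → a ∈ sharedQuads
      from a∈ with (x , q) , xq∈ , refl ← ∈-map⁻ sharing a∈
        with x∈ , q∈ ← ∈-cartesianProduct⁻ (upTo k) (upTo k) xq∈ =
        ∈-filter⁺ shared? (quads⁺ (sort-Between x<k q<k) (sort-Between x<k (m%n<n (q + n) k)) bal)
          (shared⁺ (sort x q) (sort x w) (∈₂-sort⁺ x q (inj₁ refl)) (∈₂-sort⁺ x w (inj₁ refl)))
        where
        x<k = ∈-upTo⁻ x∈
        q<k = ∈-upTo⁻ q∈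
        w = (q + n) % k
        bal : Balanced (sort x q , sort x w)
        bal = begin
          x ⊓ q + (x ⊔ q) + n  ≡⟨ cong (_+ n) (sort-sum x q) ⟩
          x + q + n          ≡⟨ +-assoc x q n ⟩
          x + (q + n)        ≈⟨ +-cong-≈ (≈-refl {x}) (≈-sym (%-≈ (q + n))) ⟩
          x + w              ≡⟨ sort-sum x w ⟨
          x ⊓ w + (x ⊔ w)    ∎
          where
          open ≈-Reasoning

-- From representatives to the list of Parikh vectors.

module _ {A B : Set} where

  -- Chooses one y for each x; the list stays duplicate-free because no y is related to two members
  -- of `xs`. A relation is used since the vector of a quad is reached through a position that is
  -- merely known to exist.
  enumerate-image : (R : A → B → Set) {xs : List A} → Unique xs → (∀ {x} → x ∈ xs → ∃ (R x)) →
    (∀ {x x' y} → x ∈ xs → x' ∈ xs → R x y → R x' y → x ≡ x') →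
    ∃ λ ys → Unique ys × length ys ≡ length xs ×
      (∀ {y} → y ∈ ys → ∃ λ x → x ∈ xs × R x y) × (∀ {x} → x ∈ xs → ∃ λ y → y ∈ ys × R x y)
  enumerate-image R {[]} [] total inj = [] , [] , refl , (λ ()) , (λ ())
  enumerate-image R {x ∷ xs} (x∉ ∷ u) total inj
    with ys , uys , len , back , forth ← enumerate-image R u (total ∘ there) (λ p q → inj (there p) (there q))
       | y , xRy ← total (here refl) =
    y ∷ ys , All.tabulate (λ { z∈ refl → y∉ z∈ }) ∷ uys , cong suc len ,
    (λ { (here refl) → x , here refl , xRy
       ; (there z∈) → let x' , x'∈ , r = back z∈ in x' , there x'∈ , r }) ,
    (λ { (here refl) → y , here refl , xRy
       ; (there x'∈) → let z , z∈ , r = forth x'∈ in z , there z∈ , r })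
    where
    y∉ : ¬ (y ∈ ys)
    y∉ y∈ with x' , x'∈ , r ← back y∈ = All.lookup x∉ x'∈ (inj (here refl) (there x'∈) xRy r)

module Enumeration (k : ℕ) .{{_ : NonZero k}} (2≤k : 2 ≤ k) (n : ℕ) (k≤n : k ≤ n) where
  open Modular k
  open ThueMorse k 2≤k
  open Parikh k 2≤k
  open Cancellation k
  open Canonical k n

  Represents : Quad → Vec ℕ k → Set
  Represents a v = ∃ λ i → quad n i ∼ a × parikh k (factor k i n) ≡ v

  module _ {C : List Quad} (trv : Transversal C) where
    private module T = Transversal trv

    represented : ∀ {a} → a ∈ C → ∃ (Represents a)
    represented {(p , q) , (u , w)} a∈ with (p< , q< , u< , w<) , bal ← T.sound a∈
      with i , hp , hq , hu , hw ← realise k≤n p q w u bal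
      with refl ← ≈⇒≡ (t<k ((i + n) / k)) p< hp | refl ← ≈⇒≡ (t<k i) q< hq
         | refl ← ≈⇒≡ (t<k (i + n)) u< hu | refl ← ≈⇒≡ (t<k (i / k)) w< hw =
      parikh k (factor k i n) , i , mk∼ (λ _ _ → refl) , refl

    represents-inj : ∀ {a b v} → a ∈ C → b ∈ C → Represents a v → Represents b v → a ≡ b
    represents-inj a∈ b∈ (i , si , refl) (j , sj , eq) =
      T.∼⇒≡ a∈ b∈ (∼-trans (∼-sym si) (∼-trans (parikh≡⇒∼ n {i} {j} (sym eq)) sj))

    parikhVectors : ∃ λ L → Unique L × length L ≡ length C ×
      (∀ (v : Vec ℕ k) → (v ∈ L) ⇔ (∃ λ i → parikh k (factor k i n) ≡ v))
    parikhVectors with L , uL , len , back , forth ← enumerate-image Represents T.unique represented represents-inj =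
      L , uL , len , λ v → mk⇔ (λ v∈ → let _ , _ , i , _ , eq = back v∈ in i , eq)
        -- The vector enumerated for `a` stems from another position j. Both quads, at i and at j,
        -- are equivalent to `a`, so the two vectors agree.
        λ { (i , refl) →
          let a , a∈ , s = T.complete _ _ _ _ (t<k ((i + n) / k)) (t<k i) (t<k (i + n)) (t<k (i / k)) (balanced i n)
              y , y∈ , j , sj , eq = forth a∈
          in subst (_∈ L) (trans (sym eq) (∼⇒parikh≡ n {j} {i} (∼-trans sj (∼-sym s)))) y∈ }

-- Counting balanced quads according to parity.

m%2≡0∨1 : ∀ m → m % 2 ≡ 0 ⊎ m % 2 ≡ 1
m%2≡0∨1 m with m % 2 | m%n<n m 2
... | 0 | _ = inj₁ refl
... | 1 | _ = inj₂ refl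
... | suc (suc _) | s≤s (s≤s ())

sumTo-parity : ∀ h {f a b} → (∀ c → c < h * 2 → c % 2 ≡ 0 → f c ≡ a) → (∀ c → c < h * 2 → c % 2 ≡ 1 → f c ≡ b) →
  sumTo f (h * 2) ≡ h * (a + b)
sumTo-parity zero p q = refl
sumTo-parity (suc h) {f} {a} {b} p q = begin
  sumTo f (h * 2) + f (h * 2) + f (1 + h * 2)
    ≡⟨ cong₂ _+_ (cong₂ _+_ (sumTo-parity h (λ c c< → p c (m≤n⇒m≤1+n (m≤n⇒m≤1+n c<))) (λ c c< → q c (m≤n⇒m≤1+n (m≤n⇒m≤1+n c<))))
         (p (h * 2) (m≤n⇒m≤1+n ≤-refl) (m*n%n≡0 h 2))) (q (1 + h * 2) ≤-refl ([m+kn]%n≡m%n 1 h 2)) ⟩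
  h * (a + b) + a + b     ≡⟨ +-assoc (h * (a + b)) a b ⟩
  h * (a + b) + (a + b)   ≡⟨ +-comm (h * (a + b)) (a + b) ⟩
  suc h * (a + b)         ∎
  where
  open ≡-Reasoning

sumTo-* : ∀ c f m → c * sumTo f m ≡ sumTo (λ x → c * f x) m
sumTo-* c f zero = *-zeroʳ c
sumTo-* c f (suc m) = trans (*-distribˡ-+ c (sumTo f m) (f m)) (cong (_+ c * f m) (sumTo-* c f m))

module Counting (k : ℕ) .{{_ : NonZero k}} (n : ℕ) where
  open Modular k
  open PairSums k
  open Canonical k n

  numPairs : ℕ → ℕ
  numPairs c = length (pairsSumming c)

  quads-length : length quads ≡ sumTo (λ c → numPairs c * numPairs ((c + n) % k)) k
  quads-length = trans (length-concatMap-upTo block k)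
    (sumTo-cong k (λ c _ → length-cartesianProduct (pairsSumming c) (pairsSumming ((c + n) % k))))

  allPairs-length : length (concatMap pairsSumming (upTo k)) ≡ sumTo numPairs k
  allPairs-length = length-concatMap-upTo pairsSumming k

  parity-split : ∀ {c} → c < k → (c % 2 + (k ∸ c) % 2) % 2 ≡ k % 2
  parity-split {c} c<k = trans (sym (%-distribˡ-+ c (k ∸ c) 2)) (cong (_% 2) (m+[n∸m]≡n (<⇒≤ c<k)))

  numPairs-odd : k % 2 ≡ 1 → ∀ {c} → c < k → 2 * numPairs c ≡ 1 + k
  numPairs-odd odd {c} c<k with parity-split c<k | length-pairsSumming c<k
  ... | par | len with m%2≡0∨1 c | m%2≡0∨1 (k ∸ c)
  ... | inj₁ p | inj₂ q rewrite p | q = +-cancelʳ-≡ 1 _ _ (trans len (+-comm 1 (1 + k)))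
  ... | inj₂ p | inj₁ q rewrite p | q = +-cancelʳ-≡ 1 _ _ (trans len (+-comm 1 (1 + k)))
  ... | inj₁ p | inj₁ q rewrite p | q | odd = contradiction par λ ()
  ... | inj₂ p | inj₂ q rewrite p | q | odd = contradiction par λ ()

  quads-odd : k % 2 ≡ 1 → 4 * length quads ≡ k * ((1 + k) * (1 + k))
  quads-odd odd = begin
    4 * length quads                                             ≡⟨ cong (4 *_) quads-length ⟩
    4 * sumTo (λ c → numPairs c * numPairs ((c + n) % k)) k                    ≡⟨ sumTo-* 4 _ k ⟩
    sumTo (λ c → 4 * (numPairs c * numPairs ((c + n) % k))) k
      ≡⟨ sumTo-cong k (λ c c<k → trans (lem (numPairs c) (numPairs ((c + n) % k)))
           (cong₂ _*_ (numPairs-odd odd c<k) (numPairs-odd odd (m%n<n (c + n) k)))) ⟩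
    sumTo (λ _ → (1 + k) * (1 + k)) k                            ≡⟨ sumTo-const _ k ⟩
    k * ((1 + k) * (1 + k))                                      ∎
    where
    open ≡-Reasoning
    lem : ∀ a b → 4 * (a * b) ≡ 2 * a * (2 * b)
    lem = solve-∀

  allPairs-odd : k % 2 ≡ 1 → 2 * length (concatMap pairsSumming (upTo k)) ≡ k * (1 + k)
  allPairs-odd odd = trans (cong (2 *_) allPairs-length) (trans (sumTo-* 2 numPairs k)
    (trans (sumTo-cong k (λ c → numPairs-odd odd)) (sumTo-const (1 + k) k)))

  disjoint+shared : length disjointQuads + length sharedQuads ≡ length quads
  disjoint+shared = length-filter-¬ shared? quads

  module Even (h : ℕ) (k≡h*2 : k ≡ h * 2) where

    halve : ∀ m a → 2 * m + (a + a) ≡ 2 + k → 2 * (m + a) ≡ 2 * (1 + h)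
    halve m a len = trans (l m a) (trans len (trans (cong (2 +_) k≡h*2) (r h)))
      where
      l : ∀ m a → 2 * (m + a) ≡ 2 * m + (a + a)
      l = solve-∀
      r : ∀ h → 2 + h * 2 ≡ 2 * (1 + h)
      r = solve-∀

    numPairs-even : ∀ {c} → c < k → numPairs c + c % 2 ≡ 1 + h
    numPairs-even {c} c<k with parity-split c<k | length-pairsSumming c<k
    ... | par | len with m%2≡0∨1 c | m%2≡0∨1 (k ∸ c)
    ... | inj₁ p | inj₁ q rewrite p | q = *-cancelˡ-≡ _ _ 2 (halve (numPairs c) 0 len)
    ... | inj₂ p | inj₂ q rewrite p | q = *-cancelˡ-≡ _ _ 2 (halve (numPairs c) 1 len)
    ... | inj₁ p | inj₂ q rewrite p | q = contradiction (trans par (trans (cong (_% 2) k≡h*2) (m*n%n≡0 h 2))) λ ()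
    ... | inj₂ p | inj₁ q rewrite p | q = contradiction (trans par (trans (cong (_% 2) k≡h*2) (m*n%n≡0 h 2))) λ ()

    numPairs-even₀ : ∀ {c} → c < k → c % 2 ≡ 0 → numPairs c ≡ 1 + h
    numPairs-even₀ {c} c<k p = trans (sym (+-identityʳ (numPairs c))) (trans (cong (numPairs c +_) (sym p)) (numPairs-even c<k))

    numPairs-even₁ : ∀ {c} → c < k → c % 2 ≡ 1 → numPairs c ≡ h
    numPairs-even₁ {c} c<k p = suc-injective (trans (+-comm 1 (numPairs c)) (trans (cong (numPairs c +_) (sym p)) (numPairs-even c<k)))

    n%k%2≡n%2 : n % k % 2 ≡ n % 2
    n%k%2≡n%2 = m∣n⇒o%n%m≡o%m 2 k n (divides h k≡h*2)

    -- For even k, reduction modulo k keeps parity, so an even n matches sums of equal parity and an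
    -- odd n matches opposite ones.
    shift-parity : ∀ c {x y} → c % 2 ≡ x → n % 2 ≡ y → (c + n) % k % 2 ≡ (x + y) % 2
    shift-parity c refl refl = trans (m∣n⇒o%n%m≡o%m 2 k (c + n) (divides h k≡h*2)) (%-distribˡ-+ c n 2)

    sumTo-even : ∀ {f} a b → (∀ c → c < k → c % 2 ≡ 0 → f c ≡ a) → (∀ c → c < k → c % 2 ≡ 1 → f c ≡ b) →
      sumTo f k ≡ h * (a + b)
    sumTo-even {f} a b p q = trans (cong (sumTo f) k≡h*2) (sumTo-parity h
      (λ c c< → p c (subst (c <_) (sym k≡h*2) c<)) (λ c c< → q c (subst (c <_) (sym k≡h*2) c<)))

    allPairs-even : length (concatMap pairsSumming (upTo k)) ≡ h * (1 + h + h)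
    allPairs-even = trans allPairs-length (sumTo-even (1 + h) h (λ _ → numPairs-even₀) (λ _ → numPairs-even₁))

    quads-even₀ : n % 2 ≡ 0 → length quads ≡ h * ((1 + h) * (1 + h) + h * h)
    quads-even₀ n-even = trans quads-length (sumTo-even _ _
      (λ c c<k p → cong₂ _*_ (numPairs-even₀ c<k p) (numPairs-even₀ (m%n<n (c + n) k) (shift-parity c p n-even)))
      (λ c c<k p → cong₂ _*_ (numPairs-even₁ c<k p) (numPairs-even₁ (m%n<n (c + n) k) (shift-parity c p n-even))))

    quads-even₁ : n % 2 ≡ 1 → length quads ≡ h * ((1 + h) * h + h * (1 + h))
    quads-even₁ n-odd = trans quads-length (sumTo-even _ _
      (λ c c<k p → cong₂ _*_ (numPairs-even₀ c<k p) (numPairs-even₁ (m%n<n (c + n) k) (shift-parity c p n-odd)))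
      (λ c c<k p → cong₂ _*_ (numPairs-even₁ c<k p) (numPairs-even₀ (m%n<n (c + n) k) (shift-parity c p n-odd))))

-- Arithmetic of the five formulas.

m%2≡0⇒m≡h*2 : ∀ m → m % 2 ≡ 0 → m ≡ m / 2 * 2
m%2≡0⇒m≡h*2 m p = trans (m≡m%n+[m/n]*n m 2) (cong (_+ m / 2 * 2) p)

-- In integers, 4 (A - S) = k (k + 1)² - 2k (k + 1) = k (k² - 1); adding 4S to both sides avoids the
-- subtraction.
odd-divisible : ∀ k N S {A} .{{_ : NonZero k}} → N + S ≡ A → 2 * S ≡ k * (1 + k) → 4 * A ≡ k * ((1 + k) * (1 + k)) →
  4 * (N + 1) ≡ k * (k ^ 2 ∸ 1) + 4
odd-divisible (suc j) N S refl hS hA = +-cancelʳ-≡ (2 * (2 * S)) _ _ (begin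
  4 * (N + 1) + 2 * (2 * S)                  ≡⟨ r₁ N S ⟩
  4 * (N + S) + 4                            ≡⟨ cong (_+ 4) hA ⟩
  (1 + j) * ((2 + j) * (2 + j)) + 4          ≡⟨ r₂ j ⟩
  (1 + j) * (j * (2 + j)) + 4 + 2 * ((1 + j) * (2 + j))
    ≡⟨ cong₂ (λ x y → (1 + j) * x + 4 + 2 * y) (cong pred (r₃ j)) (sym hS) ⟩
  (1 + j) * ((1 + j) ^ 2 ∸ 1) + 4 + 2 * (2 * S)    ∎)
  where
  open ≡-Reasoning
  r₁ : ∀ N S → 4 * (N + 1) + 2 * (2 * S) ≡ 4 * (N + S) + 4
  r₁ = solve-∀
  r₂ : ∀ j → (1 + j) * ((2 + j) * (2 + j)) + 4 ≡ (1 + j) * (j * (2 + j)) + 4 + 2 * ((1 + j) * (2 + j))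
  r₂ = solve-∀
  r₃ : ∀ j → 1 + j * (2 + j) ≡ (1 + j) * ((1 + j) * 1)
  r₃ = solve-∀

odd-indivisible : ∀ k N {A} .{{_ : NonZero k}} → N + k * k ≡ A → 4 * A ≡ k * ((1 + k) * (1 + k)) →
  4 * (N + k) ≡ k * (k ∸ 1) ^ 2 + 4 * k
odd-indivisible k@(suc j) N refl hA = +-cancelʳ-≡ (4 * (k * k)) _ _
  (trans (r₁ N k) (trans (cong (_+ 4 * k) hA) (r₂ j)))
  where
  r₁ : ∀ N k → 4 * (N + k) + 4 * (k * k) ≡ 4 * (N + k * k) + 4 * k
  r₁ = solve-∀
  r₂ : ∀ j → (1 + j) * ((2 + j) * (2 + j)) + 4 * (1 + j) ≡ (1 + j) * (j * (j * 1)) + 4 * (1 + j) + 4 * ((1 + j) * (1 + j))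
  r₂ = solve-∀

even-divisible : ∀ {k} h N {S A} → k ≡ h * 2 → N + S ≡ A → S ≡ h * (1 + h + h) → A ≡ h * ((1 + h) * (1 + h) + h * h) →
  4 * (N + 1) ≡ k ^ 3 + 4
even-divisible h N refl hN refl hA = +-cancelʳ-≡ (4 * (h * (1 + h + h))) _ _
  (trans (r₁ N (h * (1 + h + h))) (trans (cong (λ x → 4 * x + 4) (trans hN hA)) (r₂ h)))
  where
  r₁ : ∀ N S → 4 * (N + 1) + 4 * S ≡ 4 * (N + S) + 4
  r₁ = solve-∀
  r₂ : ∀ h → 4 * (h * ((1 + h) * (1 + h) + h * h)) + 4 ≡ (h * 2) * ((h * 2) * ((h * 2) * 1)) + 4 + 4 * (h * (1 + h + h))
  r₂ = solve-∀

-- The fifth k: with M_c alternating between h + 1 and h, matching equal parities makes A exceed k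
-- (k + 1)²/4 by k/4.
even-indivisible₀ : ∀ {k} h N {A} .{{_ : NonZero k}} → k ≡ h * 2 → N + k * k ≡ A → A ≡ h * ((1 + h) * (1 + h) + h * h) →
  4 * (N + k) ≡ k * (k ∸ 1) ^ 2 + 5 * k
even-indivisible₀ (suc g) N refl hN hA = +-cancelʳ-≡ (4 * (k * k)) _ _
  (trans (r₁ N k) (trans (cong (λ x → 4 * x + 4 * k) (trans hN hA)) (r₂ g)))
  where
  k = suc g * 2
  r₁ : ∀ N k → 4 * (N + k) + 4 * (k * k) ≡ 4 * (N + k * k) + 4 * k
  r₁ = solve-∀
  r₂ : ∀ g → 4 * ((1 + g) * ((2 + g) * (2 + g) + (1 + g) * (1 + g))) + 4 * ((1 + g) * 2) ≡
    (1 + g) * 2 * ((1 + g * 2) * ((1 + g * 2) * 1)) + 5 * ((1 + g) * 2) + 4 * ((1 + g) * 2 * ((1 + g) * 2))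
  r₂ = solve-∀

even-indivisible₁ : ∀ {k} h N {A} .{{_ : NonZero k}} → k ≡ h * 2 → N + k * k ≡ A → A ≡ h * ((1 + h) * h + h * (1 + h)) →
  4 * (N + k) ≡ k ^ 2 * (k ∸ 2) + 4 * k
even-indivisible₁ (suc g) N refl hN hA = +-cancelʳ-≡ (4 * (k * k)) _ _
  (trans (r₁ N k) (trans (cong (λ x → 4 * x + 4 * k) (trans hN hA)) (r₂ g)))
  where
  k = suc g * 2
  r₁ : ∀ N k → 4 * (N + k) + 4 * (k * k) ≡ 4 * (N + k * k) + 4 * k
  r₁ = solve-∀
  r₂ : ∀ g → 4 * ((1 + g) * ((2 + g) * (1 + g) + (1 + g) * (2 + g))) + 4 * ((1 + g) * 2) ≡
    (1 + g) * 2 * ((1 + g) * 2 * 1) * (g * 2) + 4 * ((1 + g) * 2) + 4 * ((1 + g) * 2 * ((1 + g) * 2))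
  r₂ = solve-∀

-- The complexity appears as the length of a duplicate-free list of exactly the Parikh vectors that
-- occur, and the factor 4 clears the denominators. With k ≥ 2 the truncated subtractions are
-- genuine ones.
theorem1 : (k : ℕ) .{{_ : NonZero k}} → 2 ≤ k → (n : ℕ) → k ≤ n →
    Σ (List (Vec ℕ k)) λ L →
    Unique L ×
    (∀ (v : Vec ℕ k) → (v ∈ L) ⇔ (∃ λ i → parikh k (factor k i n) ≡ v)) ×
    ((k % 2 ≡ 1 → n % k ≡ 0 → 4 * length L ≡ k * (k ^ 2 ∸ 1) + 4) ×
    (k % 2 ≡ 1 → n % k ≢ 0 → 4 * length L ≡ k * (k ∸ 1) ^ 2 + 4 * k) ×
    (k % 2 ≡ 0 → n % k ≡ 0 → 4 * length L ≡ k ^ 3 + 4) ×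
    (k % 2 ≡ 0 → n % k ≢ 0 → (n % k) % 2 ≡ 0 →
    4 * length L ≡ k * (k ∸ 1) ^ 2 + 5 * k) ×
    (k % 2 ≡ 0 → n % k ≢ 0 → (n % k) % 2 ≡ 1 →
    4 * length L ≡ k ^ 2 * (k ∸ 2) + 4 * k))
theorem1 k 2≤k n k≤n with n % k ≟ 0
... | yes n%k≡0 = L , uL , mem ,
    (λ odd _ → trans 4|L| (odd-divisible k (length disjointQuads) (length (concatMap pairsSumming (upTo k))) N+S≡A
      (allPairs-odd odd) (quads-odd odd))) ,
    (λ _ ≢0 → contradiction n%k≡0 ≢0) ,
    (λ even _ → let k≡ = m%2≡0⇒m≡h*2 k even in
      trans 4|L| (even-divisible (k / 2) (length disjointQuads) k≡ N+S≡A (Even.allPairs-even (k / 2) k≡)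
        (Even.quads-even₀ (k / 2) k≡ (trans (sym (Even.n%k%2≡n%2 (k / 2) k≡)) (cong (_% 2) n%k≡0))))) ,
    (λ _ ≢0 → contradiction n%k≡0 ≢0) ,
    (λ _ ≢0 → contradiction n%k≡0 ≢0)
  where
  open Modular k
  open Canonical k n
  open PairSums k
  open Counting k n
  0<k = ≤-trans (s≤s z≤n) 2≤k
  n≈0 : n ≈ 0
  n≈0 = mk (trans n%k≡0 (sym (m<n⇒m%n≡m 0<k)))
  open Divisible n≈0
  vectors = Enumeration.parikhVectors k 2≤k n k≤n (transversal (degenerates 0<k))
  L = proj₁ vectors
  uL = proj₁ (proj₂ vectors)
  mem = proj₂ (proj₂ (proj₂ vectors))
  4|L| : 4 * length L ≡ 4 * (length disjointQuads + 1)
  4|L| = cong (4 *_) (trans (proj₁ (proj₂ (proj₂ vectors))) (length-++ disjointQuads))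
  N+S≡A : length disjointQuads + length (concatMap pairsSumming (upTo k)) ≡ length quads
  N+S≡A = trans (cong (length disjointQuads +_) (sym sharedQuads-length)) disjoint+shared
... | no n%k≢0 = L , uL , mem ,
    (λ _ ≡0 → contradiction ≡0 n%k≢0) ,
    (λ odd _ → trans 4|L| (odd-indivisible k (length disjointQuads) N+k²≡A (quads-odd odd))) ,
    (λ _ ≡0 → contradiction ≡0 n%k≢0) ,
    (λ even _ r-even → let k≡ = m%2≡0⇒m≡h*2 k even in
      trans 4|L| (even-indivisible₀ (k / 2) (length disjointQuads) k≡ N+k²≡A
        (Even.quads-even₀ (k / 2) k≡ (trans (sym (Even.n%k%2≡n%2 (k / 2) k≡)) r-even)))) ,
    (λ even _ r-odd → let k≡ = m%2≡0⇒m≡h*2 k even in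
      trans 4|L| (even-indivisible₁ (k / 2) (length disjointQuads) k≡ N+k²≡A
        (Even.quads-even₁ (k / 2) k≡ (trans (sym (Even.n%k%2≡n%2 (k / 2) k≡)) r-odd))))
  where
  open Modular k
  open Canonical k n
  open Counting k n
  n≉0 : ¬ (n ≈ 0)
  n≉0 (mk h) = n%k≢0 (trans h (m<n⇒m%n≡m (≤-trans (s≤s z≤n) 2≤k)))
  open Indivisible n≉0
  vectors = Enumeration.parikhVectors k 2≤k n k≤n (transversal degenerates)
  L = proj₁ vectors
  uL = proj₁ (proj₂ vectors)
  mem = proj₂ (proj₂ (proj₂ vectors))
  4|L| : 4 * length L ≡ 4 * (length disjointQuads + k)
  4|L| = cong (4 *_) (trans (proj₁ (proj₂ (proj₂ vectors))) (trans (length-++ disjointQuads)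
    (cong (length disjointQuads +_) (trans (length-map (λ q → degenerate q ((q + n) % k)) (upTo k)) (length-upTo k)))))
  N+k²≡A : length disjointQuads + k * k ≡ length quads
  N+k²≡A = trans (cong (length disjointQuads +_) (sym sharedQuads-length)) disjoint+shared
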